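{- There is an absolute constant $C>0$ such that the following holds. Let $r\ge 2$ and $k\ge 1$ be integers, and let $0<\delta\le 1$ be a real number such that $n=(1+\delta)r^k$ is an integer. Then in every $k$-edge-coloring of $K_n$ there is a monochromatic subgraph $H$ with $\chi(H)\ge r+1$ and \[\operatorname{diam}(H)\le C\,k^{3/2}\,\delta^{ -1/2}\log r .\]
   Context: $K_n$ denotes the complete graph on $n$ vertices. A $k$-edge-coloring of a graph is an arbitrary assignment of one of $k$ colors to each edge; a subgraph (not necessarily induced or spanning) is monochromatic if all of its edges have the same color. $\chi(H)$ denotes the chromatic number of a graph $H$. The diameter $\operatorname{diam}(H)$ is the maximum over pairs $u,v\in V(H)$ of the length (number of edges) of a shortest path in $H$ between $u$ and $v$ (infinite if $H$ is disconnected). -}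

module Defs where

open import Algebra.Definitions.RawSemiring using (_^_)
open import Data.Fin using (Fin)
open import Data.Fin.Properties using (_≟_)
open import Data.Fin.Subset using (Subset; _∈_; _⊆_; ⊤)
open import Data.Fin.Subset.Properties using (∈⊤)
open import Data.Integer using (+_)
open import Data.List using (List; []; _∷_)
open import Data.List.Relation.Unary.Unique.Propositional using (Unique)
open import Data.Nat as ℕ using (ℕ; zero; suc)
open import Data.Product using (Σ; ∃-syntax; _×_; _,_)
open import Data.Rational using (ℚ; 0ℚ; 1ℚ; _+_; _*_; -_; _<_; _≤_; _/_; 1/_; Positive; +-*-rawSemiring)
open import Data.Rational.Properties using (pos⇒nonZero)
open import Data.Sum using (_⊎_)
open import Level using (0ℓ)
open import Relation.Binary using (Rel; Decidable; Symmetric; Irreflexive)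
open import Relation.Binary.PropositionalEquality using (_≡_; _≢_; refl; ≢-sym)
open import Relation.Nullary using (¬?)
open import Relation.Unary using (Pred) renaming (_∈_ to _∈ₚ_; _⊆_ to _⊆ₚ_)

-- Finite simple graphs, with vertex set a subset of Fin N.

record Graph (N : ℕ) : Set₁ where
  field
    V       : Subset N
    E       : Rel (Fin N) 0ℓ
    E?      : Decidable E
    E-sym   : Symmetric E
    E-irr   : Irreflexive _≡_ E
    E⇒∈     : ∀ {u v} → E u v → u ∈ V

open Graph public

K : (n : ℕ) → Graph n
K n = record
  { V     = ⊤
  ; E     = _≢_
  ; E?    = λ u v → ¬? (u ≟ v)
  ; E-sym = ≢-sym
  ; E-irr = λ u≡v u≢v → u≢v u≡v
  ; E⇒∈   = λ _ → ∈⊤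
  }

record _⊆ᴳ_ {N : ℕ} (H G : Graph N) : Set where
  field
    V⊆ : V H ⊆ V G
    E⊆ : ∀ {u v} → E H u v → E G u v

open _⊆ᴳ_ public

-- With E symmetric, colour-sym also makes colour e depend only on the
-- endpoints of e, not on the proof that they are adjacent.
record EdgeColouring {N : ℕ} (G : Graph N) (k : ℕ) : Set where
  field
    colour     : ∀ {u v} → E G u v → Fin k
    colour-sym : ∀ {u v} (e : E G u v) (e′ : E G v u) → colour e ≡ colour e′

open EdgeColouring public

Monochromatic : ∀ {N k} {H G : Graph N} → EdgeColouring G k → H ⊆ᴳ G → Set
Monochromatic {H = H} c H⊆G =
  ∃[ a ] (∀ {u v} (e : E H u v) → colour c (E⊆ H⊆G e) ≡ a)

-- Only the values of f on V H matter.
Colourable : ∀ {N} → Graph N → ℕ → Set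
Colourable {N} H m =
  Σ (Fin N → ℕ) λ f →
    (∀ {v} → v ∈ V H → f v ℕ.< m) × (∀ {u v} → E H u v → f u ≢ f v)

IsChromaticNumber : ∀ {N} → Graph N → ℕ → Set
IsChromaticNumber H χ = Colourable H χ × (∀ m → Colourable H m → χ ℕ.≤ m)

data Walk {N : ℕ} (H : Graph N) : Fin N → Fin N → ℕ → Set where
  [_]    : ∀ {v} → v ∈ V H → Walk H v v 0
  _∷_    : ∀ {u v w l} → E H u v → Walk H v w l → Walk H u w (suc l)

vertices : ∀ {N} {H : Graph N} {u v l} → Walk H u v l → List (Fin N)
vertices {u = u} [ _ ]   = u ∷ []
vertices {u = u} (_ ∷ p) = u ∷ vertices p

Path : ∀ {N} → Graph N → Fin N → Fin N → ℕ → Set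
Path H u v l = Σ (Walk H u v l) λ p → Unique (vertices p)

IsDistance : ∀ {N} → Graph N → Fin N → Fin N → ℕ → Set
IsDistance H u v d = Path H u v d × (∀ l → Path H u v l → d ℕ.≤ l)

-- A (finite) diameter; a disconnected graph has none.
IsDiameter : ∀ {N} → Graph N → ℕ → Set
IsDiameter H d =
  (∀ u v → u ∈ V H → v ∈ V H → ∃[ e ] (IsDistance H u v e × e ℕ.≤ d))
  × (∃[ u ] ∃[ v ] (u ∈ V H × v ∈ V H × IsDistance H u v d))

-- A real number x is represented by its open lower cut { q ∈ ℚ ∣ q < x };
-- the order of the reals is then inclusion of cuts.

ℝₗ : Set₁
ℝₗ = Pred ℚ 0ℓ

_≤ᴿ_ : ℝₗ → ℝₗ → Set
x ≤ᴿ y = x ⊆ₚ y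

ℕ→ℚ : ℕ → ℚ
ℕ→ℚ m = + m / 1

ℚ→ℝ : ℚ → ℝₗ
ℚ→ℝ p q = q < p

ℕ→ℝ : ℕ → ℝₗ
ℕ→ℝ m = ℚ→ℝ (ℕ→ℚ m)

-- Multiplication of non-negative reals.
_·_ : ℝₗ → ℝₗ → ℝₗ
(x · y) q =
  q < 0ℚ ⊎ ∃[ a ] ∃[ b ] (0ℚ ≤ a × 0ℚ ≤ b × a ∈ₚ x × b ∈ₚ y × q < a * b)

-- The square root of a non-negative rational.
√ : ℚ → ℝₗ
√ x q = q < 0ℚ ⊎ q * q < x

-- e^x is the supremum of (1 + x/m)^m over the m ≥ 1 with 1 + x/m ≥ 0,
-- because (1 + x/m)^m is increasing over those m, with limit e^x.
exp : ℚ → ℝₗ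
exp x q = ∃[ j ] (0ℚ ≤ base j × q < (base j ^ℚ suc j))
  where
  _^ℚ_ : ℚ → ℕ → ℚ
  _^ℚ_ = _^_ +-*-rawSemiring
  base : ℕ → ℚ
  base j = 1ℚ + x * (+ 1 / suc j)

-- Natural logarithm: q < log r iff e^(-q) > 1/r, that is, iff some
-- p < e^(-q) satisfies 1 ≤ r p.
log : ℕ → ℝₗ
log r q = ∃[ p ] (p ∈ₚ exp (- q) × 1ℚ ≤ ℕ→ℚ r * p)

_^-½ : (δ : ℚ) .{{_ : Positive δ}} → ℝₗ
δ ^-½ = √ ((1/ δ) {{pos⇒nonZero δ}})

_^³ᐟ² : ℕ → ℝₗ
k ^³ᐟ² = √ (ℕ→ℚ (k ℕ.^ 3))

infix  4 _⊆ᴳ_ _≤ᴿ_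
infixl 7 _·_
infix  8 _^-½ _^³ᐟ²
infixr 5 _∷_

{-# OPTIONS --safe #-}
module Submission where

-- The proof follows the multiplicativity of the Lovász theta function. Let G be one
-- colour class and suppose every ball of radius R in G is r-colourable. Weight the ball
-- around c by w_c(v) = (m/(m+1))^d(v,c), cut off at distance R, and normalise so that
-- ∑_c w_c(v)² ≈ 1. Since w_c changes by a factor of at most 1 ± 1/m along an edge, the inner
-- products ∑_c w_c(u) w_c(v) over the edges of G differ from 1 by O(1/m²) only, provided the
-- cut-off is negligible, i.e. R ≳ m log(n m²). (This second-order gain is the source of the
-- exponent -1/2 of δ.) Combining w_c with a simplex embedding of the r-colouring of the ball
-- around c gives a positive semidefinite matrix A with 0 ≤ 1 + A everywhere, 1 + A ≤ r on
-- the diagonal and 1 + A ≤ η = O(1/m²) on the edges of G.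
--
-- If this holds for all k colours, then every pair of distinct vertices is an edge of some
-- colour, and the Schur product of the matrices 1 + A_i forces n (1 - k η) ≤ r^k. This fails
-- for n = (1 + δ) r^k and m a suitable multiple of √(k/δ). So some ball of radius R is not
-- r-colourable, and with log(n m²) = O(k log r) its diameter has the required order; here
-- δ ≥ r^(-k) is used, which holds because n is an integer.

open import Defs
open import Algebra.Bundles using (CommutativeRing)
open import Data.Bool using (true; if_then_else_)
open import Data.Fin using (Fin; zero; suc; toℕ; fromℕ<; finToFun; funToFin)
import Data.Fin.Properties as Fin
open import Data.Fin.Subset using (Subset; _∈_; ⊤)
open import Data.Fin.Subset.Properties using (∈⊤; _∈?_)
import Data.Integer as ℤ
import Data.Integer.Properties as ℤ
import Data.List.Membership.Propositional as List
import Data.List.Relation.Unary.All as All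
open import Data.List.Relation.Unary.All.Properties using (¬Any⇒All¬)
open import Data.List.Relation.Unary.Any using (here; there)
open import Data.List.Relation.Unary.Unique.Propositional using (Unique; []; _∷_)
open import Data.Nat using (ℕ; zero; suc)
import Data.Nat as ℕ
import Data.Nat.DivMod as ℕ
import Data.Nat.Properties as ℕ
open import Data.Nat.Solver using (module +-*-Solver)
open import Data.Product using (Σ; ∃-syntax; _×_; _,_; proj₁; proj₂)
open import Data.Rational using (ℚ; 0ℚ; 1ℚ; ½; _+_; _*_; -_; _-_; _≤_; _<_; _/_; 1/_;
  Positive; positive; nonNegative; toℚᵘ; +-*-rawSemiring)
open import Data.Rational.Properties
import Data.Rational.Unnormalised as ℚᵘ
import Data.Rational.Unnormalised.Properties as ℚᵘ
open import Data.Sum using (_⊎_; inj₁; inj₂)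
open import Data.Vec using (tabulate)
open import Data.Vec.Properties using (lookup∘tabulate; lookup⇒[]=; []=⇒lookup)
open import Relation.Binary using (tri<; tri≈; tri>)
open import Relation.Binary.PropositionalEquality using (_≡_; _≢_; refl; sym; trans; cong; cong₂;
  subst; subst₂; ≢-sym; module ≡-Reasoning)
open import Relation.Nullary using (¬_; Dec; yes; no; does; contradiction; ¬?; _×-dec_; _→-dec_)
open import Relation.Nullary.Decidable using (map′; decidable-stable; dec-true; dec-false; dec⇒maybe; from-yes)
open import Relation.Unary using (Decidable)
open import Tactic.RingSolver using (solve-∀)
open import Tactic.RingSolver.Core.AlmostCommutativeRing using (AlmostCommutativeRing; fromCommutativeRing)
open import Algebra.Definitions.RawSemiring +-*-rawSemiring using (_^_)
open import Algebra.Properties.Group +-0-group using () renaming (∙-cancelˡ to +-cancelˡ)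
open import Algebra.Properties.Semiring.Sum (CommutativeRing.semiring +-*-commutativeRing)
  using (sum; sum-cong-≗; ∑-distrib-+; *-distribˡ-sum; *-distribʳ-sum)

-- Inequalities and finite sums over the rationals

ℚ-ring : AlmostCommutativeRing _ _
ℚ-ring = fromCommutativeRing +-*-commutativeRing (λ x → dec⇒maybe (0ℚ ≟ x))


-- Reduces an inequality to a ring identity: `d` is an explicit nonnegative expression for the
-- difference.
≤-by : ∀ {x y d : ℚ} → 0ℚ ≤ d → y ≡ x + d → x ≤ y
≤-by {x} {y} {d} 0≤d y≡x+d = begin
  x       ≡⟨ +-identityʳ x ⟨
  x + 0ℚ  ≤⟨ +-monoʳ-≤ x 0≤d ⟩
  x + d   ≡⟨ y≡x+d ⟨
  y       ∎
  where open ≤-Reasoning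

0≤y-x : ∀ {x y : ℚ} → x ≤ y → 0ℚ ≤ y - x
0≤y-x {x} {y} x≤y = begin
  0ℚ     ≡⟨ +-inverseʳ x ⟨
  x - x  ≤⟨ +-monoˡ-≤ (- x) x≤y ⟩
  y - x  ∎
  where open ≤-Reasoning

+-nonNeg : ∀ {x y : ℚ} → 0ℚ ≤ x → 0ℚ ≤ y → 0ℚ ≤ x + y
+-nonNeg 0≤x 0≤y = +-mono-≤ 0≤x 0≤y

*-monoˡ-≤ : ∀ {z x y : ℚ} → 0ℚ ≤ z → x ≤ y → z * x ≤ z * y
*-monoˡ-≤ {z} 0≤z = *-monoˡ-≤-nonNeg z {{nonNegative 0≤z}}

*-monoʳ-≤ : ∀ {z x y : ℚ} → 0ℚ ≤ z → x ≤ y → x * z ≤ y * z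
*-monoʳ-≤ {z} 0≤z = *-monoʳ-≤-nonNeg z {{nonNegative 0≤z}}

*-nonNeg : ∀ {x y : ℚ} → 0ℚ ≤ x → 0ℚ ≤ y → 0ℚ ≤ x * y
*-nonNeg {x} {y} 0≤x 0≤y = subst (_≤ x * y) (*-zeroʳ x) (*-monoˡ-≤ 0≤x 0≤y)

*-mono-≤ : ∀ {w x y z : ℚ} → 0ℚ ≤ w → 0ℚ ≤ y → w ≤ x → y ≤ z → w * y ≤ x * z
*-mono-≤ 0≤w 0≤y w≤x y≤z =
  ≤-trans (*-monoˡ-≤ 0≤w y≤z) (*-monoʳ-≤ (≤-trans 0≤y y≤z) w≤x)

square-nonNeg : ∀ (x : ℚ) → 0ℚ ≤ x * x
square-nonNeg x with ≤-total 0ℚ x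
... | inj₁ 0≤x = *-nonNeg 0≤x 0≤x
... | inj₂ x≤0 = subst (0ℚ ≤_) (neg²  x) (*-nonNeg (neg-antimono-≤ x≤0) (neg-antimono-≤ x≤0))
  where
  neg² : ∀ x → - x * - x ≡ x * x
  neg² = solve-∀ ℚ-ring

sum-mono : ∀ {n} {f g : Fin n → ℚ} → (∀ i → f i ≤ g i) → sum f ≤ sum g
sum-mono {zero}  f≤g = ≤-refl
sum-mono {suc n} f≤g = +-mono-≤ (f≤g zero) (sum-mono (λ i → f≤g (suc i)))

sum-zero : ∀ n → sum {n} (λ _ → 0ℚ) ≡ 0ℚ
sum-zero zero    = refl
sum-zero (suc n) = trans (+-identityˡ _) (sum-zero n)

sum-nonNeg : ∀ {n} {f : Fin n → ℚ} → (∀ i → 0ℚ ≤ f i) → 0ℚ ≤ sum f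
sum-nonNeg {n} {f} 0≤f = subst (_≤ sum f) (sum-zero n) (sum-mono 0≤f)

term≤sum : ∀ {n} {f : Fin n → ℚ} → (∀ i → 0ℚ ≤ f i) → ∀ i → f i ≤ sum f
term≤sum {suc n} {f} 0≤f zero    = ≤-by (sum-nonNeg (λ i → 0≤f (suc i))) refl
term≤sum {suc n} {f} 0≤f (suc i) =
  ≤-trans (term≤sum (λ j → 0≤f (suc j)) i) (≤-by (0≤f zero) (+-comm (f zero) _))

ℕ→ℚ-+ : ∀ a b → ℕ→ℚ (a ℕ.+ b) ≡ ℕ→ℚ a + ℕ→ℚ b
ℕ→ℚ-+ a b = toℚᵘ-injective (begin
  toℚᵘ (ℕ→ℚ (a ℕ.+ b))                      ≈⟨ toℚᵘ-fromℚᵘ _ ⟩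
  ℚᵘ.mkℚᵘ (ℤ.+ (a ℕ.+ b)) 0
    ≈⟨ ℚᵘ.*≡* (cong (ℤ._* ℤ.+ 1) (sym (cong₂ ℤ._+_ (ℤ.*-identityʳ (ℤ.+ a)) (ℤ.*-identityʳ (ℤ.+ b))))) ⟩
  ℚᵘ.mkℚᵘ (ℤ.+ a) 0 ℚᵘ.+ ℚᵘ.mkℚᵘ (ℤ.+ b) 0
    ≈⟨ ℚᵘ.+-cong (toℚᵘ-fromℚᵘ (ℚᵘ.mkℚᵘ (ℤ.+ a) 0)) (toℚᵘ-fromℚᵘ (ℚᵘ.mkℚᵘ (ℤ.+ b) 0)) ⟨
  toℚᵘ (ℕ→ℚ a) ℚᵘ.+ toℚᵘ (ℕ→ℚ b)            ≈⟨ toℚᵘ-homo-+ (ℕ→ℚ a) (ℕ→ℚ b) ⟨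
  toℚᵘ (ℕ→ℚ a + ℕ→ℚ b)                      ∎)
  where open ℚᵘ.≃-Reasoning

ℕ→ℚ-* : ∀ a b → ℕ→ℚ (a ℕ.* b) ≡ ℕ→ℚ a * ℕ→ℚ b
ℕ→ℚ-* a b = toℚᵘ-injective (begin
  toℚᵘ (ℕ→ℚ (a ℕ.* b))                      ≈⟨ toℚᵘ-fromℚᵘ _ ⟩
  ℚᵘ.mkℚᵘ (ℤ.+ (a ℕ.* b)) 0                 ≈⟨ ℚᵘ.*≡* (cong (ℤ._* ℤ.+ 1) (ℤ.pos-* a b)) ⟩
  ℚᵘ.mkℚᵘ (ℤ.+ a) 0 ℚᵘ.* ℚᵘ.mkℚᵘ (ℤ.+ b) 0
    ≈⟨ ℚᵘ.*-cong (toℚᵘ-fromℚᵘ (ℚᵘ.mkℚᵘ (ℤ.+ a) 0)) (toℚᵘ-fromℚᵘ (ℚᵘ.mkℚᵘ (ℤ.+ b) 0)) ⟨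
  toℚᵘ (ℕ→ℚ a) ℚᵘ.* toℚᵘ (ℕ→ℚ b)            ≈⟨ toℚᵘ-homo-* (ℕ→ℚ a) (ℕ→ℚ b) ⟨
  toℚᵘ (ℕ→ℚ a * ℕ→ℚ b)                      ∎)
  where open ℚᵘ.≃-Reasoning

ℕ→ℚ-mono-≤ : ∀ {a b} → a ℕ.≤ b → ℕ→ℚ a ≤ ℕ→ℚ b
ℕ→ℚ-mono-≤ {a} {b} a≤b = toℚᵘ-cancel-≤
  (ℚᵘ.≤-respˡ-≃ (ℚᵘ.≃-sym (toℚᵘ-fromℚᵘ (ℚᵘ.mkℚᵘ (ℤ.+ a) 0)))
    (ℚᵘ.≤-respʳ-≃ (ℚᵘ.≃-sym (toℚᵘ-fromℚᵘ (ℚᵘ.mkℚᵘ (ℤ.+ b) 0)))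
      (ℚᵘ.*≤* (ℤ.*-monoʳ-≤-nonNeg (ℤ.+ 1) (ℤ.+≤+ a≤b)))))

ℕ→ℚ-mono-< : ∀ {a b} → a ℕ.< b → ℕ→ℚ a < ℕ→ℚ b
ℕ→ℚ-mono-< {a} {b} a<b = toℚᵘ-cancel-<
  (ℚᵘ.<-respˡ-≃ (ℚᵘ.≃-sym (toℚᵘ-fromℚᵘ (ℚᵘ.mkℚᵘ (ℤ.+ a) 0)))
    (ℚᵘ.<-respʳ-≃ (ℚᵘ.≃-sym (toℚᵘ-fromℚᵘ (ℚᵘ.mkℚᵘ (ℤ.+ b) 0)))
      (ℚᵘ.*<* (ℤ.*-monoʳ-<-pos (ℤ.+ 1) (ℤ.+<+ a<b)))))

0≤ℕ→ℚ : ∀ a → 0ℚ ≤ ℕ→ℚ a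
0≤ℕ→ℚ a = ℕ→ℚ-mono-≤ {0} {a} ℕ.z≤n

sum-one : ∀ n → sum {n} (λ _ → 1ℚ) ≡ ℕ→ℚ n
sum-one zero    = refl
sum-one (suc n) = trans (cong (1ℚ +_) (sum-one n)) (sym (ℕ→ℚ-+ 1 n))

-- Positive semidefinite matrices and Schur multipliers

Matrix : ℕ → Set
Matrix n = Fin n → Fin n → ℚ

_⊙_ : ∀ {n} → Matrix n → Matrix n → Matrix n
(A ⊙ B) u v = A u v * B u v

infixl 7 _⊙_

form : ∀ {n} → (Fin n → ℚ) → Matrix n → ℚ
form x M = sum λ u → sum λ v → x u * x v * M u v

total : ∀ {n} → Matrix n → ℚ
total M = sum λ u → sum λ v → M u v

PSD : ∀ {n} → Matrix n → Set
PSD M = ∀ x → 0ℚ ≤ form x M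

-- For symmetric matrices this is positive semidefiniteness, by the Schur product theorem. With the
-- conclusion of that theorem as definition, closure under `⊙` and under sums is immediate, and only
-- rank-one matrices need an argument.
SchurMultiplier : ∀ {n} → Matrix n → Set
SchurMultiplier A = ∀ M → PSD M → PSD (A ⊙ M)

sum²-cong : ∀ {m n} {f g : Fin m → Fin n → ℚ} → (∀ u v → f u v ≡ g u v) →
            sum (λ u → sum (f u)) ≡ sum (λ u → sum (g u))
sum²-cong f≗g = sum-cong-≗ (λ u → sum-cong-≗ (f≗g u))

sum²-+ : ∀ {m n} (f g : Fin m → Fin n → ℚ) →
         sum (λ u → sum (λ v → f u v + g u v)) ≡ sum (λ u → sum (f u)) + sum (λ u → sum (g u))
sum²-+ f g = trans (sum-cong-≗ (λ u → ∑-distrib-+ (f u) (g u))) (∑-distrib-+ (λ u → sum (f u)) (λ u → sum (g u)))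

sum²-*ˡ : ∀ {m n} a (f : Fin m → Fin n → ℚ) →
          sum (λ u → sum (λ v → a * f u v)) ≡ a * sum (λ u → sum (f u))
sum²-*ˡ a f = trans (sum-cong-≗ (λ u → sym (*-distribˡ-sum a (f u)))) (sym (*-distribˡ-sum a (λ u → sum (f u))))

form-cong : ∀ {n} x {A B : Matrix n} → (∀ u v → A u v ≡ B u v) → form x A ≡ form x B
form-cong x A≗B = sum²-cong (λ u v → cong (x u * x v *_) (A≗B u v))

form-+ : ∀ {n} x (A B : Matrix n) → form x (λ u v → A u v + B u v) ≡ form x A + form x B
form-+ x A B = trans (sum²-cong (λ u v → *-distribˡ-+ (x u * x v) (A u v) (B u v)))
                       (sum²-+ (λ u v → x u * x v * A u v) (λ u v → x u * x v * B u v))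

form-* : ∀ {n} x a (A : Matrix n) → form x (λ u v → a * A u v) ≡ a * form x A
form-* x a A = trans (sum²-cong (λ u v → swap (x u * x v) a (A u v))) (sum²-*ˡ a (λ u v → x u * x v * A u v))
  where
  swap : ∀ x a b → x * (a * b) ≡ a * (x * b)
  swap = solve-∀ ℚ-ring

form-0 : ∀ {n} x → form {n} x (λ _ _ → 0ℚ) ≡ 0ℚ
form-0 {n} x = trans (sum-cong-≗ (λ u → trans (sum-cong-≗ (λ v → *-zeroʳ (x u * x v))) (sum-zero n)))
                     (sum-zero n)

form-one : ∀ {n} (M : Matrix n) → form (λ _ → 1ℚ) M ≡ total M
form-one M = sum²-cong (λ u v → *-identityˡ (M u v))

schur-cong : ∀ {n} {A B : Matrix n} → (∀ u v → A u v ≡ B u v) → SchurMultiplier A → SchurMultiplier B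
schur-cong A≗B sA M pM x =
  subst (0ℚ ≤_) (form-cong x (λ u v → cong (_* M u v) (A≗B u v))) (sA M pM x)

schur-⊙ : ∀ {n} {A B : Matrix n} → SchurMultiplier A → SchurMultiplier B → SchurMultiplier (A ⊙ B)
schur-⊙ {A = A} {B} sA sB M pM x =
  subst (0ℚ ≤_) (form-cong x (λ u v → sym (*-assoc (A u v) (B u v) (M u v)))) (sA (B ⊙ M) (sB M pM) x)

schur-sum : ∀ {m n} (A : Fin m → Matrix n) → (∀ c → SchurMultiplier (A c)) →
            SchurMultiplier (λ u v → sum (λ c → A c u v))
schur-sum {zero} A sA M pM x =
  ≤-reflexive (sym (trans (form-cong x (λ u v → *-zeroˡ (M u v))) (form-0 x)))
schur-sum {suc m} A sA M pM x = subst (0ℚ ≤_)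
  (sym (trans (form-cong x (λ u v → *-distribʳ-+ (M u v) (A zero u v) _)) (form-+ x _ _)))
  (+-nonNeg (sA zero M pM x) (schur-sum (λ c → A (suc c)) (λ c → sA (suc c)) M pM x))

-- The form of the product with `M` at `x` is the form of `M` at the pointwise product of `x` and
-- `g`.
schur-rank-one : ∀ {n} (g : Fin n → ℚ) → SchurMultiplier (λ u v → g u * g v)
schur-rank-one g M pM x =
  subst (0ℚ ≤_) (sum²-cong (λ u v → regroup (x u) (x v) (g u) (g v) (M u v))) (pM (λ u → x u * g u))
  where
  regroup : ∀ x y a b m → x * a * (y * b) * m ≡ x * y * (a * b * m)
  regroup = solve-∀ ℚ-ring

schur-unscale : ∀ {n} {A : Matrix n} a → 0ℚ < a → SchurMultiplier (λ u v → a * A u v) → SchurMultiplier A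
schur-unscale {A = A} a 0<a saA M pM x = *-cancelˡ-≤-pos a {{positive 0<a}} (begin
  a * 0ℚ              ≡⟨ *-zeroʳ a ⟩
  0ℚ                  ≤⟨ saA M pM x ⟩
  form x _            ≡⟨ form-cong x (λ u v → *-assoc a (A u v) (M u v)) ⟩
  form x _            ≡⟨ form-* x a (A ⊙ M) ⟩
  a * form x (A ⊙ M)  ∎)
  where open ≤-Reasoning

-- The regular simplex

δ[_,_] : ∀ {r} → Fin r → Fin r → ℚ
δ[ p , q ] = if does (p Fin.≟ q) then 1ℚ else 0ℚ

-- The Gram matrix of the vertices of a regular simplex, scaled so that
-- distinct vertices have inner product -1.
simplex : ∀ {r} → Fin r → Fin r → ℚ
simplex {r} p q = ℕ→ℚ r * δ[ p , q ] - 1ℚ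

δ-refl : ∀ {r} (p : Fin r) → δ[ p , p ] ≡ 1ℚ
δ-refl p rewrite dec-true (p Fin.≟ p) refl = refl

δ-≢ : ∀ {r} {p q : Fin r} → p ≢ q → δ[ p , q ] ≡ 0ℚ
δ-≢ {p = p} {q} p≢q rewrite dec-false (p Fin.≟ q) p≢q = refl

sum-δ : ∀ {r} (p : Fin r) (f : Fin r → ℚ) → sum (λ a → δ[ a , p ] * f a) ≡ f p
sum-δ {suc r} zero f = trans
  (cong₂ _+_ (*-identityˡ (f zero)) (trans (sum-cong-≗ {r} (λ a → *-zeroˡ (f (suc a)))) (sum-zero r)))
  (+-identityʳ (f zero))
sum-δ {suc r} (suc p) f = trans (cong₂ _+_ (*-zeroˡ (f zero)) (sum-δ p (λ a → f (suc a)))) (+-identityˡ _)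

-- The matrix is `r I - J` with `J` all ones, and `J² = r J` gives `(r I - J)² = r (r I - J)`. So
-- `r` times it is a sum of `r` rational rank-one matrices, without square roots.
sum-simplex : ∀ {r} (p q : Fin r) →
              sum (λ a → simplex a p * simplex a q) ≡ ℕ→ℚ r * simplex p q
sum-simplex {r} p q = begin
  sum (λ a → simplex a p * simplex a q)
    ≡⟨ sum-cong-≗ (λ a → expand ρ δ[ a , p ] δ[ a , q ]) ⟩
  sum (λ a → δ[ a , p ] * (ρ * ρ * δ[ a , q ] - ρ) + (δ[ a , q ] * (- ρ) + 1ℚ))
    ≡⟨ ∑-distrib-+ (λ a → δ[ a , p ] * (ρ * ρ * δ[ a , q ] - ρ)) (λ a → δ[ a , q ] * (- ρ) + 1ℚ) ⟩
  sum (λ a → δ[ a , p ] * (ρ * ρ * δ[ a , q ] - ρ)) + sum (λ a → δ[ a , q ] * (- ρ) + 1ℚ)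
    ≡⟨ cong₂ _+_ (sum-δ p (λ a → ρ * ρ * δ[ a , q ] - ρ))
         (trans (∑-distrib-+ (λ a → δ[ a , q ] * (- ρ)) (λ _ → 1ℚ)) (cong₂ _+_ (sum-δ q (λ _ → - ρ)) (sum-one r))) ⟩
  ρ * ρ * δ[ p , q ] - ρ + (- ρ + ρ)
    ≡⟨ collect ρ δ[ p , q ] ⟩
  ρ * simplex p q ∎
  where
  open ≡-Reasoning
  ρ = ℕ→ℚ r
  expand : ∀ ρ x y → (ρ * x - 1ℚ) * (ρ * y - 1ℚ) ≡ x * (ρ * ρ * y - ρ) + (y * (- ρ) + 1ℚ)
  expand = solve-∀ ℚ-ring
  collect : ∀ ρ x → ρ * ρ * x - ρ + (- ρ + ρ) ≡ ρ * (ρ * x - 1ℚ)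
  collect = solve-∀ ℚ-ring

schur-simplex : ∀ {r n} → 1 ℕ.≤ r → (φ : Fin n → Fin r) → SchurMultiplier (λ u v → simplex (φ u) (φ v))
schur-simplex {r} 1≤r φ = schur-unscale (ℕ→ℚ r) (ℕ→ℚ-mono-< 1≤r)
  (schur-cong (λ u v → sum-simplex (φ u) (φ v))
    (schur-sum (λ a u v → simplex a (φ u) * simplex a (φ v)) (λ a → schur-rank-one (λ u → simplex a (φ u)))))

-- Sums of matrix entries

all-ones : ∀ {n} → Matrix n
all-ones _ _ = 1ℚ

PSD-all-ones : ∀ {n} → PSD (all-ones {n})
PSD-all-ones {n} x = subst (0ℚ ≤_) square (square-nonNeg (sum x))
  where
  open ≡-Reasoning
  square : sum x * sum x ≡ form x all-ones
  square = begin
    sum x * sum x                           ≡⟨ *-distribʳ-sum (sum x) x ⟩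
    sum (λ u → x u * sum x)                 ≡⟨ sum-cong-≗ (λ u → *-distribˡ-sum (x u) x) ⟩
    sum (λ u → sum (λ v → x u * x v))       ≡⟨ sum²-cong (λ u v → *-identityʳ (x u * x v)) ⟨
    form x all-ones                         ∎

total-all-ones : ∀ n → total (all-ones {n}) ≡ ℕ→ℚ n * ℕ→ℚ n
total-all-ones n = begin
  sum {n} (λ _ → sum {n} (λ _ → 1ℚ))  ≡⟨ sum-cong-≗ {n} (λ _ → trans (sum-one n) (sym (*-identityʳ _))) ⟩
  sum {n} (λ _ → ℕ→ℚ n * 1ℚ)          ≡⟨ *-distribˡ-sum (ℕ→ℚ n) (λ (_ : Fin n) → 1ℚ) ⟨
  ℕ→ℚ n * sum {n} (λ _ → 1ℚ)          ≡⟨ cong (ℕ→ℚ n *_) (sum-one n) ⟩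
  ℕ→ℚ n * ℕ→ℚ n                       ∎
  where open ≡-Reasoning

total-mono : ∀ {n} {A B : Matrix n} → (∀ u v → A u v ≤ B u v) → total A ≤ total B
total-mono A≤B = sum-mono (λ u → sum-mono (A≤B u))

PSD⇒total-nonNeg : ∀ {n} (M : Matrix n) → PSD M → 0ℚ ≤ total M
PSD⇒total-nonNeg M pM = subst (0ℚ ≤_) (form-one M) (pM (λ _ → 1ℚ))

total-sum-≤ : ∀ {m n} (M : Fin m → Matrix n) X → (∀ j → total (M j) ≤ X) →
              total (λ u v → sum (λ j → M j u v)) ≤ ℕ→ℚ m * X
total-sum-≤ {zero} {n} M X M≤X = ≤-reflexive
  (trans (trans (sum-cong-≗ {n} (λ _ → sum-zero n)) (sum-zero n)) (sym (*-zeroˡ X)))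
total-sum-≤ {suc m} M X M≤X = begin
  total (λ u v → M zero u v + sum (λ j → M (suc j) u v))
    ≡⟨ sum²-+ (M zero) (λ u v → sum (λ j → M (suc j) u v)) ⟩
  total (M zero) + total (λ u v → sum (λ j → M (suc j) u v))
    ≤⟨ +-mono-≤ (M≤X zero) (total-sum-≤ (λ j → M (suc j)) X (λ j → M≤X (suc j))) ⟩
  X + ℕ→ℚ m * X
    ≡⟨ cong (_+ ℕ→ℚ m * X) (*-identityˡ X) ⟨
  1ℚ * X + ℕ→ℚ m * X
    ≡⟨ *-distribʳ-+ X 1ℚ (ℕ→ℚ m) ⟨
  (1ℚ + ℕ→ℚ m) * X
    ≡⟨ cong (_* X) (ℕ→ℚ-+ 1 m) ⟨
  ℕ→ℚ (suc m) * X ∎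
  where open ≤-Reasoning

total-diagonal : ∀ n a → total {n} (λ u v → δ[ v , u ] * a) ≡ ℕ→ℚ n * a
total-diagonal n a = begin
  sum {n} (λ u → sum {n} (λ v → δ[ v , u ] * a))  ≡⟨ sum-cong-≗ {n} (λ u → trans (sum-δ u (λ _ → a)) (sym (*-identityʳ a))) ⟩
  sum {n} (λ _ → a * 1ℚ)                          ≡⟨ *-distribˡ-sum a (λ (_ : Fin n) → 1ℚ) ⟨
  a * sum {n} (λ _ → 1ℚ)                          ≡⟨ trans (cong (a *_) (sum-one n)) (*-comm a (ℕ→ℚ n)) ⟩
  ℕ→ℚ n * a                                       ∎
  where open ≡-Reasoning

-- Schur products of `k` matrices and the clique bound

schurProduct : ∀ {k n} → (Fin k → Matrix n) → Matrix n
schurProduct {zero}  B = all-ones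
schurProduct {suc k} B = B zero ⊙ schurProduct (λ i → B (suc i))

schurProductExcept : ∀ {k n} → Fin k → (Fin k → Matrix n) → Matrix n
schurProductExcept zero    B = schurProduct (λ i → B (suc i))
schurProductExcept (suc j) B = B zero ⊙ schurProductExcept j (λ i → B (suc i))

schurProduct-split : ∀ {k n} j (B : Fin k → Matrix n) u v →
                     schurProduct B u v ≡ B j u v * schurProductExcept j B u v
schurProduct-split zero    B u v = refl
schurProduct-split (suc j) B u v =
  trans (cong (B zero u v *_) (schurProduct-split j (λ i → B (suc i)) u v))
        (swap (B zero u v) (B (suc j) u v) (schurProductExcept j (λ i → B (suc i)) u v))
  where
  swap : ∀ x y z → x * (y * z) ≡ y * (x * z)
  swap = solve-∀ ℚ-ring

schurProduct-nonNeg : ∀ {k n} (B : Fin k → Matrix n) {u v} → (∀ i → 0ℚ ≤ B i u v) → 0ℚ ≤ schurProduct B u v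
schurProduct-nonNeg {zero}  B 0≤B = 0≤ℕ→ℚ 1
schurProduct-nonNeg {suc k} B 0≤B = *-nonNeg (0≤B zero) (schurProduct-nonNeg (λ i → B (suc i)) (λ i → 0≤B (suc i)))

schurProductExcept-nonNeg : ∀ {k n} j (B : Fin k → Matrix n) {u v} → (∀ i → 0ℚ ≤ B i u v) →
                            0ℚ ≤ schurProductExcept j B u v
schurProductExcept-nonNeg zero    B 0≤B = schurProduct-nonNeg (λ i → B (suc i)) (λ i → 0≤B (suc i))
schurProductExcept-nonNeg (suc j) B 0≤B =
  *-nonNeg (0≤B zero) (schurProductExcept-nonNeg j (λ i → B (suc i)) (λ i → 0≤B (suc i)))

schurProduct-≤ : ∀ {k n} r (B : Fin k → Matrix n) {u v} → (∀ i → 0ℚ ≤ B i u v) → (∀ i → B i u v ≤ ℕ→ℚ r) →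
                 schurProduct B u v ≤ ℕ→ℚ (r ℕ.^ k)
schurProduct-≤ {zero}  r B 0≤B B≤r = ≤-refl
schurProduct-≤ {suc k} r B {u} {v} 0≤B B≤r = begin
  B zero u v * schurProduct (λ i → B (suc i)) u v
    ≤⟨ *-mono-≤ (0≤B zero) (schurProduct-nonNeg (λ i → B (suc i)) (λ i → 0≤B (suc i))) (B≤r zero)
         (schurProduct-≤ r (λ i → B (suc i)) (λ i → 0≤B (suc i)) (λ i → B≤r (suc i))) ⟩
  ℕ→ℚ r * ℕ→ℚ (r ℕ.^ k)
    ≡⟨ ℕ→ℚ-* r (r ℕ.^ k) ⟨
  ℕ→ℚ (r ℕ.^ suc k) ∎
  where open ≤-Reasoning

1+_ : ∀ {n} → Matrix n → Matrix n
(1+ A) u v = 1ℚ + A u v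

1+-⊙ : ∀ {n} (A M : Matrix n) u v → ((1+ A) ⊙ M) u v ≡ M u v + (A ⊙ M) u v
1+-⊙ A M u v = trans (*-distribʳ-+ (M u v) 1ℚ (A u v)) (cong (_+ A u v * M u v) (*-identityˡ (M u v)))

PSD-1+ : ∀ {n} (A M : Matrix n) → SchurMultiplier A → PSD M → PSD ((1+ A) ⊙ M)
PSD-1+ A M sA pM x = subst (0ℚ ≤_)
  (sym (trans (form-cong x (1+-⊙ A M)) (form-+ x M (A ⊙ M))))
  (+-nonNeg (pM x) (sA M pM x))

-- The difference `A ⊙ M` is positive semidefinite, and the sum of its entries is its form at the
-- all-ones vector.
total-1+ : ∀ {n} (A M : Matrix n) → SchurMultiplier A → PSD M → total M ≤ total ((1+ A) ⊙ M)
total-1+ A M sA pM = ≤-by (PSD⇒total-nonNeg (A ⊙ M) (sA M pM))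
  (trans (sum²-cong (1+-⊙ A M)) (sum²-+ M (A ⊙ M)))

module _ {n : ℕ} where

  PSD-schurProduct : ∀ {k} (A : Fin k → Matrix n) → (∀ i → SchurMultiplier (A i)) →
                     PSD (schurProduct (λ i → 1+ A i))
  PSD-schurProduct {zero}  A sA = PSD-all-ones
  PSD-schurProduct {suc k} A sA = PSD-1+ (A zero) (schurProduct (λ i → 1+ A (suc i))) (sA zero)
    (PSD-schurProduct (λ i → A (suc i)) (λ i → sA (suc i)))

  PSD-schurProductExcept : ∀ {k} j (A : Fin k → Matrix n) → (∀ i → SchurMultiplier (A i)) →
                           PSD (schurProductExcept j (λ i → 1+ A i))
  PSD-schurProductExcept zero    A sA = PSD-schurProduct (λ i → A (suc i)) (λ i → sA (suc i))
  PSD-schurProductExcept (suc j) A sA =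
    PSD-1+ (A zero) (schurProductExcept j (λ i → 1+ A (suc i))) (sA zero)
      (PSD-schurProductExcept j (λ i → A (suc i)) (λ i → sA (suc i)))

  -- The factors are multiplied in one at a time, starting from the all-ones matrix with sum `n²`;
  -- by `total-1+` none of them lowers the sum.
  n²≤total : ∀ {k} (A : Fin k → Matrix n) → (∀ i → SchurMultiplier (A i)) →
             ℕ→ℚ n * ℕ→ℚ n ≤ total (schurProduct (λ i → 1+ A i))
  n²≤total {zero}  A sA = ≤-reflexive (sym (total-all-ones n))
  n²≤total {suc k} A sA = ≤-trans (n²≤total (λ i → A (suc i)) (λ i → sA (suc i)))
    (total-1+ (A zero) (schurProduct (λ i → 1+ A (suc i))) (sA zero)
    (PSD-schurProduct (λ i → A (suc i)) (λ i → sA (suc i))))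

  total-except-≤ : ∀ {k} j (A : Fin k → Matrix n) → (∀ i → SchurMultiplier (A i)) →
                   total (schurProductExcept j (λ i → 1+ A i)) ≤ total (schurProduct (λ i → 1+ A i))
  total-except-≤ j A sA = ≤-trans (total-1+ (A j) (schurProductExcept j (λ i → 1+ A i)) (sA j) (PSD-schurProductExcept j A sA))
    (≤-reflexive (sym (sum²-cong (schurProduct-split j (λ i → 1+ A i)))))

-- Division by `n`, which for `n = 0` is replaced by the hypothesis `0ℚ ≤ y`.
cancel-factor : ∀ n {y} x → 0ℚ ≤ y → ℕ→ℚ n * (ℕ→ℚ n * x) ≤ ℕ→ℚ n * y → ℕ→ℚ n * x ≤ y
cancel-factor zero    x 0≤y _     = ≤-trans (≤-reflexive (*-zeroˡ x)) 0≤y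
cancel-factor (suc n) x 0≤y nx≤ny =
  *-cancelˡ-≤-pos (ℕ→ℚ (suc n)) {{positive (ℕ→ℚ-mono-< (ℕ.s≤s (ℕ.z≤n {n})))}} nx≤ny

-- In the sum X of the entries of P = ∏ (1 + Aᵢ), the off-diagonal entries are at
-- most η ∑ⱼ ∏_{i≠j} (1 + Aᵢ), and the entries of each of these k products sum to
-- at most X, because P - ∏_{i≠j} (1 + Aᵢ) = Aⱼ ∏_{i≠j} (1 + Aᵢ) is positive
-- semidefinite. Hence n² (1 - k η) ≤ X (1 - k η) ≤ n rᵏ.
clique-bound : ∀ {k n} r (η : ℚ) (A : Fin k → Matrix n) →
               0ℚ ≤ η → ℕ→ℚ k * η ≤ 1ℚ →
               (∀ i → SchurMultiplier (A i)) →
               (∀ i u v → 0ℚ ≤ 1ℚ + A i u v) →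
               (∀ i v → 1ℚ + A i v v ≤ ℕ→ℚ r) →
               (∀ u v → u ≢ v → ∃[ i ] (1ℚ + A i u v ≤ η)) →
               ℕ→ℚ n * (1ℚ - ℕ→ℚ k * η) ≤ ℕ→ℚ (r ℕ.^ k)
clique-bound {k} {n} r η A 0≤η kη≤1 sA 0≤B diag edge =
  cancel-factor n (1ℚ - ℕ→ℚ k * η) (0≤ℕ→ℚ (r ℕ.^ k)) (begin
    ν * (ν * (1ℚ - ℕ→ℚ k * η))       ≡⟨ *-assoc ν ν _ ⟨
    ν * ν * (1ℚ - ℕ→ℚ k * η)         ≤⟨ *-monoʳ-≤ (0≤y-x kη≤1) (n²≤total A sA) ⟩
    X * (1ℚ - ℕ→ℚ k * η)             ≡⟨ expand X (ℕ→ℚ k) η ⟩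
    X - η * (ℕ→ℚ k * X)              ≤⟨ +-monoˡ-≤ (- (η * (ℕ→ℚ k * X))) X≤ ⟩
    ν * N + η * (ℕ→ℚ k * X) - η * (ℕ→ℚ k * X)  ≡⟨ cancel (ν * N) (η * (ℕ→ℚ k * X)) ⟩
    ν * N                            ∎)
  where
  open ≤-Reasoning
  B : Fin k → Matrix n
  B i = 1+ A i
  ν = ℕ→ℚ n
  N = ℕ→ℚ (r ℕ.^ k)
  X = total (schurProduct B)
  Y : Matrix n
  Y u v = sum (λ j → schurProductExcept j B u v)

  expand : ∀ x k η → x * (1ℚ - k * η) ≡ x - η * (k * x)
  expand = solve-∀ ℚ-ring
  cancel : ∀ x y → x + y - y ≡ x
  cancel = solve-∀ ℚ-ring

  0≤Y : ∀ u v → 0ℚ ≤ Y u v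
  0≤Y u v = sum-nonNeg (λ j → schurProductExcept-nonNeg j B (λ i → 0≤B i u v))

  entry : ∀ u v → schurProduct B u v ≤ δ[ v , u ] * N + η * Y u v
  entry u v with v Fin.≟ u
  ... | yes refl = begin
    schurProduct B u u        ≤⟨ schurProduct-≤ r B (λ i → 0≤B i u u) (λ i → diag i u) ⟩
    N                         ≤⟨ ≤-by (*-nonNeg 0≤η (0≤Y u u)) refl ⟩
    N + η * Y u u             ≡⟨ cong (_+ η * Y u u) (*-identityˡ N) ⟨
    1ℚ * N + η * Y u u        ∎
  -- The colour `j` depends on the pair, so the product without factor `j` is bounded by the sum `Y`
  -- over all colours.
  ... | no v≢u with j , Bj≤η ← edge u v (λ u≡v → v≢u (sym u≡v)) = begin
    schurProduct B u v                    ≡⟨ schurProduct-split j B u v ⟩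
    B j u v * schurProductExcept j B u v  ≤⟨ *-monoʳ-≤ (schurProductExcept-nonNeg j B (λ i → 0≤B i u v)) Bj≤η ⟩
    η * schurProductExcept j B u v
      ≤⟨ *-monoˡ-≤ 0≤η (term≤sum (λ j → schurProductExcept-nonNeg j B (λ i → 0≤B i u v)) j) ⟩
    η * Y u v                             ≡⟨ +-identityˡ (η * Y u v) ⟨
    0ℚ + η * Y u v                        ≡⟨ cong (_+ η * Y u v) (*-zeroˡ N) ⟨
    0ℚ * N + η * Y u v                    ∎

  X≤ : X ≤ ν * N + η * (ℕ→ℚ k * X)
  X≤ = begin
    X
      ≤⟨ total-mono {A = schurProduct B} {λ u v → δ[ v , u ] * N + η * Y u v} entry ⟩
    total {n} (λ u v → δ[ v , u ] * N + η * Y u v)   ≡⟨ sum²-+ (λ u v → δ[ v , u ] * N) (λ u v → η * Y u v) ⟩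
    total {n} (λ u v → δ[ v , u ] * N) + total {n} (λ u v → η * Y u v)
                                                   ≡⟨ cong₂ _+_ (total-diagonal n N) (sum²-*ˡ η Y) ⟩
    ν * N + η * total Y
      ≤⟨ +-monoʳ-≤ (ν * N) (*-monoˡ-≤ 0≤η (total-sum-≤ (λ j → schurProductExcept j B) X (λ j → total-except-≤ j A sA))) ⟩
    ν * N + η * (ℕ→ℚ k * X)                        ∎

-- The local colourings φ i c embed into simplices; A i is the Gram matrix of the direct sum over c
-- of these embeddings, scaled by h i c.
local-colourings-bound : ∀ {k n} r (η : ℚ) → 1 ℕ.≤ r → 0ℚ ≤ η → ℕ→ℚ k * η ≤ 1ℚ →
  (h : Fin k → Fin n → Fin n → ℚ) (φ : Fin k → Fin n → Fin n → Fin r) →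
  (∀ i c v → 0ℚ ≤ h i c v) →
  (∀ i v → sum (λ c → h i c v * h i c v) ≤ 1ℚ) →
  (∀ u v → u ≢ v → ∃[ i ] ((∀ c → h i c u * h i c v ≡ 0ℚ ⊎ φ i c u ≢ φ i c v)
                           × 1ℚ - η ≤ sum (λ c → h i c u * h i c v))) →
  ℕ→ℚ n * (1ℚ - ℕ→ℚ k * η) ≤ ℕ→ℚ (r ℕ.^ k)
local-colourings-bound {k} {n} r η 1≤r 0≤η kη≤1 h φ 0≤h norm edge =
  clique-bound r η A 0≤η kη≤1
    (λ i → schur-sum (λ c u v → h i c u * h i c v * simplex (φ i c u) (φ i c v))
      (λ c → schur-⊙ {A = λ u v → h i c u * h i c v} {λ u v → simplex (φ i c u) (φ i c v)}
        (schur-rank-one (h i c)) (schur-simplex 1≤r (φ i c))))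
    nonNeg diag off
  where
  open ≤-Reasoning
  ρ = ℕ→ℚ r
  A : Fin k → Matrix n
  A i u v = sum (λ c → h i c u * h i c v * simplex (φ i c u) (φ i c v))

  S : Fin k → Matrix n
  S i u v = sum (λ c → h i c u * h i c v)

  -- Cauchy-Schwarz for vectors of norm at most 1, in the form `2xy ≤ x² + y²` summed over `c`.
  S≤1 : ∀ i u v → S i u v ≤ 1ℚ
  S≤1 i u v = *-cancelˡ-≤-pos (1ℚ + 1ℚ) (begin
    (1ℚ + 1ℚ) * S i u v    ≡⟨ *-distribˡ-sum (1ℚ + 1ℚ) (λ c → h i c u * h i c v) ⟩
    sum (λ c → (1ℚ + 1ℚ) * (h i c u * h i c v))
      ≤⟨ sum-mono (λ c → ≤-by (square-nonNeg (h i c u - h i c v)) (amgm (h i c u) (h i c v))) ⟩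
    sum (λ c → h i c u * h i c u + h i c v * h i c v)
      ≡⟨ ∑-distrib-+ (λ c → h i c u * h i c u) (λ c → h i c v * h i c v) ⟩
    S i u u + S i v v      ≤⟨ +-mono-≤ (norm i u) (norm i v) ⟩
    1ℚ + 1ℚ                ≡⟨ *-identityʳ (1ℚ + 1ℚ) ⟨
    (1ℚ + 1ℚ) * 1ℚ         ∎)
    where
    amgm : ∀ x y → x * x + y * y ≡ (1ℚ + 1ℚ) * (x * y) + (x - y) * (x - y)
    amgm = solve-∀ ℚ-ring

  0≤δ : ∀ p q → 0ℚ ≤ δ[_,_] {r} p q
  0≤δ p q with p Fin.≟ q
  ... | yes _ = 0≤ℕ→ℚ 1
  ... | no _  = ≤-refl

  -- The simplex entries are `ρ δ - 1`, so `A` is a sum of nonnegative terms minus `S`, and `S ≤ 1`.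
  nonNeg : ∀ i u v → 0ℚ ≤ 1ℚ + A i u v
  nonNeg i u v = begin
    0ℚ                            ≤⟨ 0≤y-x (S≤1 i u v) ⟩
    1ℚ - S i u v
      ≤⟨ ≤-by {1ℚ - S i u v} {1ℚ + A i u v} (sum-nonNeg (λ c → *-nonNeg (*-nonNeg (0≤h i c u) (0≤h i c v)) (*-nonNeg (0≤ℕ→ℚ r) (0≤δ (φ i c u) (φ i c v)))))
                                       (trans (cancel (S i u v) (A i u v)) (cong (1ℚ - S i u v +_) (sym regroup))) ⟩
    1ℚ + A i u v                  ∎
    where
    split : ∀ x y → x * y ≡ x + x * (y - 1ℚ)
    split = solve-∀ ℚ-ring
    cancel : ∀ x y → 1ℚ + y ≡ 1ℚ - x + (x + y)
    cancel = solve-∀ ℚ-ring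
    regroup : sum (λ c → h i c u * h i c v * (ρ * δ[ φ i c u , φ i c v ])) ≡ S i u v + A i u v
    regroup = trans (sum-cong-≗ (λ c → split (h i c u * h i c v) (ρ * δ[ φ i c u , φ i c v ])))
      (∑-distrib-+ (λ c → h i c u * h i c v) (λ c → h i c u * h i c v * simplex (φ i c u) (φ i c v)))

  0≤ρ-1 : 0ℚ ≤ ρ - 1ℚ
  0≤ρ-1 = 0≤y-x (ℕ→ℚ-mono-≤ 1≤r)

  -- On the diagonal every simplex entry is `ρ - 1`, so `A` is `(ρ - 1) S` there.
  diag : ∀ i v → 1ℚ + A i v v ≤ ρ
  diag i v = begin
    1ℚ + A i v v
      ≡⟨ cong (1ℚ +_) (trans (sum-cong-≗ (λ c → trans (cong (λ x → h i c v * h i c v * (ρ * x - 1ℚ)) (δ-refl (φ i c v)))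
                                     (factor ρ (h i c v * h i c v)))) (sym (*-distribˡ-sum (ρ - 1ℚ) (λ c → h i c v * h i c v)))) ⟩
    1ℚ + (ρ - 1ℚ) * S i v v     ≤⟨ +-monoʳ-≤ 1ℚ (*-monoˡ-≤ 0≤ρ-1 (norm i v)) ⟩
    1ℚ + (ρ - 1ℚ) * 1ℚ          ≡⟨ simplify ρ ⟩
    ρ                           ∎
    where
    factor : ∀ ρ x → x * (ρ * 1ℚ - 1ℚ) ≡ (ρ - 1ℚ) * x
    factor = solve-∀ ℚ-ring
    simplify : ∀ ρ → 1ℚ + (ρ - 1ℚ) * 1ℚ ≡ ρ
    simplify = solve-∀ ℚ-ring

  -- In each term the weights vanish or the colours differ, in which case the simplex entry is -1.
  -- Hence `A = - S` at this pair, and `S` is at least `1 - η`.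
  off : ∀ u v → u ≢ v → ∃[ i ] (1ℚ + A i u v ≤ η)
  off u v u≢v with i , proper , close ← edge u v u≢v = i , (begin
    1ℚ + A i u v
      ≡⟨ cong (1ℚ +_) (trans (sum-cong-≗ (λ c → term c (proper c))) (sym (*-distribˡ-sum (- 1ℚ) (λ c → h i c u * h i c v)))) ⟩
    1ℚ + - 1ℚ * S i u v  ≤⟨ ≤-by (0≤y-x close) (rearrange (S i u v) η) ⟩
    η                    ∎)
    where
    rearrange : ∀ s η → η ≡ 1ℚ + - 1ℚ * s + (s - (1ℚ - η))
    rearrange = solve-∀ ℚ-ring
    zero-case : ∀ y → 0ℚ * y ≡ - 1ℚ * 0ℚ
    zero-case = solve-∀ ℚ-ring
    proper-case : ∀ x ρ → x * (ρ * 0ℚ - 1ℚ) ≡ - 1ℚ * x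
    proper-case = solve-∀ ℚ-ring
    term : ∀ c → h i c u * h i c v ≡ 0ℚ ⊎ φ i c u ≢ φ i c v →
           h i c u * h i c v * simplex (φ i c u) (φ i c v) ≡ - 1ℚ * (h i c u * h i c v)
    term c (inj₁ hh≡0) rewrite hh≡0 = zero-case (simplex (φ i c u) (φ i c v))
    term c (inj₂ φ≢)   rewrite δ-≢ φ≢ = proper-case (h i c u * h i c v) ρ

-- Least solutions of decidable predicates

-- Only numbers below the bound are tested; the bound itself is returned when none of them satisfies
-- `P`.
least : {P : ℕ → Set} → Decidable P → ℕ → ℕ
least P? zero    = 0
least P? (suc b) = if does (P? 0) then 0 else suc (least (λ l → P? (suc l)) b)

least≤bound : {P : ℕ → Set} (P? : Decidable P) → ∀ b → least P? b ℕ.≤ b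
least≤bound P? zero = ℕ.z≤n
least≤bound P? (suc b) with P? 0
... | yes _ = ℕ.z≤n
... | no _  = ℕ.s≤s (least≤bound (λ l → P? (suc l)) b)

least-satisfies : {P : ℕ → Set} (P? : Decidable P) → ∀ b → least P? b ℕ.< b → P (least P? b)
least-satisfies P? (suc b) l<b with P? 0
... | yes p = p
... | no _  = least-satisfies (λ l → P? (suc l)) b (ℕ.s<s⁻¹ l<b)

least-minimal : {P : ℕ → Set} (P? : Decidable P) → ∀ b {l} → P l → least P? b ℕ.≤ l
least-minimal P? zero p = ℕ.z≤n
least-minimal P? (suc b) p with P? 0
least-minimal P? (suc b)         p | yes _ = ℕ.z≤n
least-minimal P? (suc b) {zero}  p | no ¬p = contradiction p ¬p
least-minimal P? (suc b) {suc l} p | no _  = ℕ.s≤s (least-minimal (λ l → P? (suc l)) b p)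

minimum : {P : ℕ → Set} → Decidable P → ∀ {l} → P l → ∃[ m ] (P m × m ℕ.≤ l × (∀ j → P j → m ℕ.≤ j))
minimum P? {l} p =
  -- The bound `suc l` makes the search reach the known solution `l`.
  least P? (suc l) ,
  least-satisfies P? (suc l) (ℕ.s≤s (least-minimal P? (suc l) p)) ,
  least-minimal P? (suc l) p ,
  λ j → least-minimal P? (suc l)

-- Walks, distances and diameters

module _ {N} (G : Graph N) where

  walk? : ∀ l u v → Dec (Walk G u v l)
  walk? zero u v = map′ (λ { (refl , u∈V) → [ u∈V ] }) (λ { [ u∈V ] → refl , u∈V }) ((u Fin.≟ v) ×-dec (u ∈? V G))
  walk? (suc l) u v = map′ (λ (_ , e , p) → e ∷ p) (λ { (e ∷ p) → _ , e , p })
    (Fin.any? (λ w → E? G u w ×-dec walk? l w v))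

  tail-from : ∀ {u v x l} (p : Walk G u v l) → x List.∈ vertices p → ∃[ j ] (j ℕ.≤ l × Walk G x v j)
  tail-from p@([ _ ])   (here refl) = _ , ℕ.≤-refl , p
  tail-from p@(_ ∷ _)   (here refl) = _ , ℕ.≤-refl , p
  tail-from (_ ∷ p)     (there x∈p) with j , j≤l , q ← tail-from p x∈p = j , ℕ.m≤n⇒m≤1+n j≤l , q

  -- If the first vertex came back later, the tail from there would be a strictly shorter walk with
  -- the same ends.
  shortest⇒path : ∀ {u v l} (p : Walk G u v l) → (∀ j → Walk G u v j → l ℕ.≤ j) → Unique (vertices p)
  shortest⇒path [ _ ]   shortest = All.[] ∷ []
  shortest⇒path (e ∷ p) shortest =
    ¬Any⇒All¬ _ (λ u∈p → let j , j≤l , q = tail-from p u∈p in ℕ.<⇒≱ (ℕ.s≤s j≤l) (shortest j q))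
    ∷ shortest⇒path p (λ j q → ℕ.s≤s⁻¹ (shortest (suc j) (e ∷ q)))

  -- The search runs over walks, whose existence is decidable by recursion on the length. A shortest
  -- walk is a path, and every path is a walk.
  distance : ∀ {u v l} → Walk G u v l → ∃[ d ] (IsDistance G u v d × d ℕ.≤ l)
  distance {u} {v} p with d , q , d≤l , minimal ← minimum (λ l → walk? l u v) p =
    d , ((q , shortest⇒path q minimal) , λ l (q′ , _) → minimal l q′) , d≤l

  -- `j < suc l` instead of `j ≤ l` is the form decided by `ℕ.anyUpTo?`.
  Within : ℕ → Fin N → Fin N → Set
  Within l u v = ∃[ j ] (j ℕ.< suc l × Walk G u v j)

  within? : ∀ l u v → Dec (Within l u v)
  within? l u v = ℕ.anyUpTo? (λ j → walk? j u v) (suc l)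

  -- The diameter is the least `d` within which all pairs lie; it is attained because `d - 1` fails
  -- for some pair.
  diameter : ∀ {c} D → c ∈ V G → (∀ u v → u ∈ V G → v ∈ V G → Within D u v) →
             ∃[ d ] (IsDiameter G d × d ℕ.≤ D)
  diameter {c} D c∈V within with minimum {P = λ d → ∀ u v → u ∈ V G → v ∈ V G → Within d u v} P? within
    where
    P? : Decidable (λ d → ∀ u v → u ∈ V G → v ∈ V G → Within d u v)
    P? d = Fin.all? (λ u → Fin.all? (λ v → u ∈? V G →-dec (v ∈? V G →-dec within? d u v)))
  ... | d , all-within , d≤D , minimal = d , (bounded , attained d all-within minimal) , d≤D
    where
    bounded : ∀ u v → u ∈ V G → v ∈ V G → ∃[ e ] (IsDistance G u v e × e ℕ.≤ d)
    bounded u v u∈V v∈V with j , j<1+d , p ← all-within u v u∈V v∈V with e , dist , e≤j ← distance p =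
      e , dist , ℕ.≤-trans e≤j (ℕ.s≤s⁻¹ j<1+d)

    attained : ∀ d → (∀ u v → u ∈ V G → v ∈ V G → Within d u v) →
               (∀ j → (∀ u v → u ∈ V G → v ∈ V G → Within j u v) → d ℕ.≤ j) →
               ∃[ u ] ∃[ v ] (u ∈ V G × v ∈ V G × IsDistance G u v d)
    -- For `d = 0` there is no smaller bound to fail, and the trivial walk at `c` serves.
    attained zero _ _ = c , c , c∈V , c∈V , (([ c∈V ] , All.[] ∷ []) , λ _ _ → ℕ.z≤n)
    attained (suc d) all-within minimal
      -- Minimality refutes the bound `d`; since everything is decidable and finite, an actual pair
      -- violating it can be found.
      with u , ¬u ← Fin.¬∀⟶∃¬ N _ (λ u → Fin.all? (λ v → u ∈? V G →-dec (v ∈? V G →-dec within? d u v)))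
                      (λ all → ℕ.1+n≰n (minimal d all))
      with v , ¬uv ← Fin.¬∀⟶∃¬ N _ (λ v → u ∈? V G →-dec (v ∈? V G →-dec within? d u v)) ¬u
      with u∈V ← decidable-stable (u ∈? V G) (λ u∉V → ¬uv (λ u∈V → contradiction u∈V u∉V))
      with v∈V ← decidable-stable (v ∈? V G) (λ v∉V → ¬uv (λ _ v∈V → contradiction v∈V v∉V))
      with j , j<2+d , p ← all-within u v u∈V v∈V
      with e , dist , e≤j ← distance p
      = u , v , u∈V , v∈V , subst (IsDistance G u v) (ℕ.≤-antisym (ℕ.≤-trans e≤j (ℕ.s≤s⁻¹ j<2+d)) 1+d≤e) dist
      where
      1+d≤e : suc d ℕ.≤ e
      1+d≤e = ℕ.≰⇒> (λ e≤d → ¬uv (λ _ _ → e , ℕ.s≤s e≤d , proj₁ (proj₁ dist)))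

  walk-snoc : ∀ {u v w l} → Walk G u v l → E G v w → Walk G u w (suc l)
  walk-snoc [ _ ]   e = e ∷ [ E⇒∈ G (E-sym G e) ]
  walk-snoc (f ∷ p) e = f ∷ walk-snoc p e

  walk-reverse : ∀ {u v l} → Walk G u v l → Walk G v u l
  walk-reverse [ u∈V ] = [ u∈V ]
  walk-reverse (e ∷ p) = walk-snoc (walk-reverse p) (E-sym G e)

  walk-++ : ∀ {u v w l m} → Walk G u v l → Walk G v w m → Walk G u w (l ℕ.+ m)
  walk-++ [ _ ]   q = q
  walk-++ (e ∷ p) q = e ∷ walk-++ p q

-- Colourings

  ProperFin : ∀ m → (Fin N → Fin m) → Set
  ProperFin m f = ∀ u v → E G u v → f u ≢ f v

  FinColourable : ℕ → Set
  FinColourable m = Σ (Fin N → Fin m) (ProperFin m)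

  -- Maps are enumerated through their codes in a finite set; properness needs only that decoding
  -- inverts encoding pointwise.
  finColourable? : ∀ m → Dec (FinColourable m)
  finColourable? m = map′ (λ (i , proper) → finToFun i , proper)
    (λ (f , proper) → funToFin f , λ u v e fu≡fv → proper u v e
      (trans (sym (Fin.finToFun-funToFin f u)) (trans fu≡fv (Fin.finToFun-funToFin f v))))
    (Fin.any? (λ i → Fin.all? (λ u → Fin.all? (λ v → E? G u v →-dec ¬? (finToFun {m} i u Fin.≟ finToFun i v)))))

  fin⇒colourable : ∀ {m} → FinColourable m → Colourable G m
  fin⇒colourable (f , proper) =
    (λ v → toℕ (f v)) , (λ {v} _ → Fin.toℕ<n (f v)) , λ e fu≡fv → proper _ _ e (Fin.toℕ-injective fu≡fv)

  -- Colours outside `V G` are arbitrary, so reduction modulo `suc m` brings them into range. On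
  -- `V G`, which contains both ends of every edge, it changes nothing.
  colourable⇒fin : ∀ {m} → Colourable G (suc m) → FinColourable (suc m)
  colourable⇒fin {m} (f , f< , proper) = g , λ u v e gu≡gv → proper e (begin
    f u        ≡⟨ toℕ-g (E⇒∈ G e) ⟨
    toℕ (g u)  ≡⟨ cong toℕ gu≡gv ⟩
    toℕ (g v)  ≡⟨ toℕ-g (E⇒∈ G (E-sym G e)) ⟩
    f v        ∎)
    where
    open ≡-Reasoning
    g : Fin N → Fin (suc m)
    g v = fromℕ< (ℕ.m%n<n (f v) (suc m))
    toℕ-g : ∀ {v} → v ∈ V G → toℕ (g v) ≡ f v
    toℕ-g {v} v∈V = trans (Fin.toℕ-fromℕ< (ℕ.m%n<n (f v) (suc m))) (ℕ.m<n⇒m%n≡m (f< v∈V))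

  colourable? : ∀ m → Dec (Colourable G m)
  colourable? zero = map′
    (λ V≡∅ → (λ _ → 0) , (λ v∈V → contradiction v∈V (V≡∅ _)) , λ e _ → V≡∅ _ (E⇒∈ G e))
    (λ (f , f< , _) v v∈V → contradiction (f< v∈V) ℕ.n≮0)
    (Fin.all? (λ v → ¬? (v ∈? V G)))
  colourable? (suc m) = map′ fin⇒colourable colourable⇒fin (finColourable? (suc m))

  colourable-mono : ∀ {m m′} → m ℕ.≤ m′ → Colourable G m → Colourable G m′
  colourable-mono m≤m′ (f , f< , proper) = f , (λ v∈V → ℕ.<-≤-trans (f< v∈V) m≤m′) , proper

  chromatic-number : ∃[ χ ] IsChromaticNumber G χ
  chromatic-number with χ , colourable , _ , minimal ← minimum colourable? {N}
      (fin⇒colourable ((λ v → v) , λ u v e u≡v → E-irr G u≡v e)) =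
    χ , colourable , minimal

  ¬colourable⇒χ>r : ∀ {r} → ¬ Colourable G r → ∃[ χ ] (IsChromaticNumber G χ × r ℕ.+ 1 ℕ.≤ χ)
  ¬colourable⇒χ>r {r} ¬col with χ , isχ ← chromatic-number =
    χ , isχ , subst (ℕ._≤ χ) (ℕ.+-comm 1 r) (ℕ.≰⇒> (λ χ≤r → ¬col (colourable-mono χ≤r (proj₁ isχ))))

-- Balls

module _ {N} (G : Graph N) where

  ball : ℕ → Fin N → Graph N
  ball R c = record
    { V     = B
    ; E     = λ u v → E G u v × u ∈ B × v ∈ B
    ; E?    = λ u v → E? G u v ×-dec (u ∈? B ×-dec v ∈? B)
    ; E-sym = λ (e , u∈B , v∈B) → E-sym G e , v∈B , u∈B
    ; E-irr = λ u≡v (e , _) → E-irr G u≡v e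
    ; E⇒∈   = λ (_ , u∈B , _) → u∈B
    }
    where
    B : Subset N
    B = tabulate (λ v → does (within? G R v c))

  ∈ball : ∀ {R c v} → Within G R v c → v ∈ V (ball R c)
  ∈ball {R} {c} {v} w = lookup⇒[]= v _ (trans (lookup∘tabulate _ v) (dec-true (within? G R v c) w))

  ball∈ : ∀ {R c v} → v ∈ V (ball R c) → Within G R v c
  ball∈ {R} {c} {v} v∈B = does⇒ (within? G R v c) (trans (sym (lookup∘tabulate _ v)) ([]=⇒lookup v∈B))
    where
    does⇒ : ∀ {A : Set} (a? : Dec A) → does a? ≡ true → A
    does⇒ (yes a) _ = a

  -- From each vertex of the walk, the rest of it is a walk to `c` of length at most `R`.
  walk-in-ball : ∀ {R c v l} → l ℕ.≤ R → Walk G v c l → Walk (ball R c) v c l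
  walk-in-ball l≤R p@([ _ ]) = [ ∈ball (_ , ℕ.s≤s l≤R , p) ]
  walk-in-ball l≤R w@(e ∷ p) =
    (e , ∈ball (_ , ℕ.s≤s l≤R , w) , ∈ball (_ , ℕ.m≤n⇒m≤1+n l≤R , p)) ∷ walk-in-ball (ℕ.<⇒≤ l≤R) p

  -- Any two vertices are joined through the centre.
  ball-diameter : ∀ R {c} → c ∈ V G → ∃[ d ] (IsDiameter (ball R c) d × d ℕ.≤ R ℕ.+ R)
  ball-diameter R {c} c∈V = diameter (ball R c) (R ℕ.+ R) (∈ball {R} (0 , ℕ.s≤s ℕ.z≤n , [ c∈V ])) within
    where
    within : ∀ u v → u ∈ V (ball R c) → v ∈ V (ball R c) → Within (ball R c) (R ℕ.+ R) u v
    within u v u∈B v∈B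
      with j , ℕ.s≤s j≤R , p ← ball∈ {R} u∈B | j′ , ℕ.s≤s j′≤R , q ← ball∈ {R} v∈B =
      j ℕ.+ j′ , ℕ.s≤s (ℕ.+-mono-≤ j≤R j′≤R) ,
      walk-++ (ball R c) (walk-in-ball j≤R p) (walk-reverse (ball R c) (walk-in-ball j′≤R q))

  -- The distance from v to c, or 1 + R if it is larger than R.
  truncatedDistance : ℕ → Fin N → Fin N → ℕ
  truncatedDistance R c v = least (λ l → walk? G l v c) (suc R)

  truncatedDistance-self : ∀ R {c} → c ∈ V G → truncatedDistance R c c ≡ 0
  truncatedDistance-self R {c} c∈V = ℕ.n≤0⇒n≡0 (least-minimal (λ l → walk? G l c c) (suc R) [ c∈V ])

  truncatedDistance≤⇒∈ball : ∀ R {c v} → truncatedDistance R c v ℕ.≤ R → v ∈ V (ball R c)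
  truncatedDistance≤⇒∈ball R {c} {v} d≤R =
    ∈ball {R} (_ , ℕ.s≤s d≤R , least-satisfies (λ l → walk? G l v c) (suc R) (ℕ.s≤s d≤R))

  truncatedDistance-lipschitz : ∀ R c {u v} → E G u v → truncatedDistance R c u ℕ.≤ suc (truncatedDistance R c v)
  truncatedDistance-lipschitz R c {u} {v} e with truncatedDistance R c v ℕ.<? suc R
  ... | yes d<1+R = least-minimal (λ l → walk? G l u c) (suc R) (e ∷ least-satisfies (λ l → walk? G l v c) (suc R) d<1+R)
  -- The value at `v` is the default `1 + R`, which no value exceeds.
  ... | no d≮1+R  = ℕ.≤-trans (least≤bound (λ l → walk? G l u c) (suc R)) (ℕ.m≤n⇒m≤1+n (ℕ.≮⇒≥ d≮1+R))

-- Colour classes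

module _ {n k} (χ : EdgeColouring (K n) k) where

  colour-irrelevant : ∀ {u v} (e e′ : u ≢ v) → colour χ e ≡ colour χ e′
  colour-irrelevant e e′ = trans (colour-sym χ e (≢-sym e)) (sym (colour-sym χ e′ (≢-sym e)))

  colourClass : Fin k → Graph n
  colourClass i = record
    { V     = ⊤
    ; E     = λ u v → Σ (u ≢ v) λ e → colour χ e ≡ i
    ; E?    = adjacent?
    ; E-sym = λ (e , eq) → ≢-sym e , trans (sym (colour-sym χ e (≢-sym e))) eq
    ; E-irr = λ u≡v (e , _) → e u≡v
    ; E⇒∈   = λ _ → ∈⊤
    }
    where
    adjacent? : ∀ u v → Dec (Σ (u ≢ v) λ e → colour χ e ≡ i)
    adjacent? u v with u Fin.≟ v
    ... | yes u≡v = no (λ (e , _) → e u≡v)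
    ... | no e = map′ (λ eq → e , eq) (λ (e′ , eq) → trans (colour-irrelevant e e′) eq) (colour χ e Fin.≟ i)

  ball⊆K : ∀ i R c → ball (colourClass i) R c ⊆ᴳ K n
  ball⊆K i R c = record { V⊆ = λ _ → ∈⊤ ; E⊆ = λ e → proj₁ (proj₁ e) }

  ball-monochromatic : ∀ i R c → Monochromatic χ (ball⊆K i R c)
  ball-monochromatic i R c = i , λ e → proj₂ (proj₁ e)

-- Smooth weights on balls

last-before : {P : ℕ → Set} → Decidable P → P 0 → ∀ b → ¬ P b → ∃[ t ] (P t × ¬ P (suc t))
last-before P? p0 zero    ¬p = contradiction p0 ¬p
last-before P? p0 (suc b) ¬p with P? b
... | yes p  = b , p , ¬p
... | no ¬pb = last-before P? p0 b ¬pb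

sqrt : ∀ s → ∃[ t ] (t ℕ.* t ℕ.≤ s × s ℕ.< suc t ℕ.* suc t)
sqrt s with t , t²≤s , ¬1+t²≤s ← last-before (λ t → t ℕ.* t ℕ.≤? s) ℕ.z≤n (suc s) (ℕ.<⇒≱ (ℕ.m≤m*n (suc s) (suc s))) =
  t , t²≤s , ℕ.≰⇒> ¬1+t²≤s

square-cancel-< : ∀ {a b} → a ℕ.* a ℕ.< b ℕ.* b → a ℕ.< b
square-cancel-< {a} {b} a²<b² = ℕ.≰⇒> (λ b≤a → ℕ.<⇒≱ a²<b² (ℕ.*-mono-≤ b≤a b≤a))

sum-ℕ→ℚ : ∀ {n} (f : Fin n → ℕ) → ∃[ s ] (sum (λ c → ℕ→ℚ (f c)) ≡ ℕ→ℚ s)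
sum-ℕ→ℚ {zero}  f = 0 , refl
sum-ℕ→ℚ {suc n} f with s , eq ← sum-ℕ→ℚ (λ c → f (suc c)) =
  f zero ℕ.+ s , trans (cong (ℕ→ℚ (f zero) +_) eq) (sym (ℕ→ℚ-+ (f zero) s))

-- weight m R d = m ^ d * (m + 1) ^ (R - d) for d ≤ R, and 0 for d > R.
weight : ℕ → ℕ → ℕ → ℕ
weight m R       zero    = suc m ℕ.^ R
weight m zero    (suc d) = 0
weight m (suc R) (suc d) = m ℕ.* weight m R d

weight-outside : ∀ m {R d} → R ℕ.< d → weight m R d ≡ 0
weight-outside m {zero}  {suc d} R<d = refl
weight-outside m {suc R} {suc d} R<d = trans (cong (m ℕ.*_) (weight-outside m (ℕ.s<s⁻¹ R<d))) (ℕ.*-zeroʳ m)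

*-swap : ∀ a b c → a ℕ.* (b ℕ.* c) ≡ b ℕ.* (a ℕ.* c)
*-swap = solve 3 (λ a b c → a :* (b :* c) := b :* (a :* c)) refl
  where open +-*-Solver

-- The cases are a step inside the ball, the step across the cut-off at `d = R`, and a step beyond
-- it, where both weights are 0.
weight-step : ∀ m R d →
  (m ℕ.* weight m R d ≡ suc m ℕ.* weight m R (suc d)) ⊎
  (weight m R d ≡ m ℕ.^ R × weight m R (suc d) ≡ 0) ⊎
  (weight m R d ≡ weight m R (suc d))
weight-step m zero    zero    = inj₂ (inj₁ (refl , refl))
weight-step m zero    (suc d) = inj₂ (inj₂ refl)
weight-step m (suc R) zero    = inj₁ (*-swap m (suc m) (suc m ℕ.^ R))
weight-step m (suc R) (suc d) with weight-step m R d
... | inj₁ eq                = inj₁ (trans (cong (m ℕ.*_) eq) (*-swap m (suc m) (weight m R (suc d))))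
... | inj₂ (inj₁ (eq , eq′)) = inj₂ (inj₁ (cong (m ℕ.*_) eq , trans (cong (m ℕ.*_) eq′) (ℕ.*-zeroʳ m)))
... | inj₂ (inj₂ eq)         = inj₂ (inj₂ (cong (m ℕ.*_) eq))

-- Inside the ball `μ x = (1 + μ) y`, so `μ (x - y)` is just `y`. At the cut-off the jump from `M`
-- to 0 is paid for by the last term.
weight-smooth-step : ∀ m R d → let μ = ℕ→ℚ m; x = ℕ→ℚ (weight m R d); y = ℕ→ℚ (weight m R (suc d)); M = ℕ→ℚ (m ℕ.^ R) in
  μ * μ * ((x - y) * (x - y)) ≤ x * x + y * y + μ * μ * (M * M)
weight-smooth-step m R d = bound (weight-step m R d)
  where
  open ≤-Reasoning
  μ = ℕ→ℚ m
  x = ℕ→ℚ (weight m R d)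
  y = ℕ→ℚ (weight m R (suc d))
  M = ℕ→ℚ (m ℕ.^ R)
  0≤μ²M² : 0ℚ ≤ μ * μ * (M * M)
  0≤μ²M² = *-nonNeg (square-nonNeg μ) (square-nonNeg M)
  pull : ∀ μ x y → μ * μ * ((x - y) * (x - y)) ≡ (μ * x - μ * y) * (μ * x - μ * y)
  pull = solve-∀ ℚ-ring
  simp : ∀ μ y → ((1ℚ + μ) * y - μ * y) * ((1ℚ + μ) * y - μ * y) ≡ y * y
  simp = solve-∀ ℚ-ring
  drop : ∀ x y z → x * x + y * y + z ≡ y * y + (x * x + z)
  drop = solve-∀ ℚ-ring
  drop′ : ∀ μ M → M * M + 0ℚ * 0ℚ + μ * μ * (M * M) ≡ μ * μ * ((M - 0ℚ) * (M - 0ℚ)) + M * M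
  drop′ = solve-∀ ℚ-ring
  drop″ : ∀ μ x z → x * x + x * x + z ≡ μ * μ * ((x - x) * (x - x)) + (x * x + x * x + z)
  drop″ = solve-∀ ℚ-ring
  bound : _ → μ * μ * ((x - y) * (x - y)) ≤ x * x + y * y + μ * μ * (M * M)
  bound (inj₁ eq) = begin
    μ * μ * ((x - y) * (x - y))                              ≡⟨ pull μ x y ⟩
    (μ * x - μ * y) * (μ * x - μ * y)                        ≡⟨ cong (λ z → (z - μ * y) * (z - μ * y)) μx≡ ⟩
    ((1ℚ + μ) * y - μ * y) * ((1ℚ + μ) * y - μ * y)          ≡⟨ simp μ y ⟩
    y * y
      ≤⟨ ≤-by (+-nonNeg (square-nonNeg x) 0≤μ²M²) (drop x y (μ * μ * (M * M))) ⟩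
    x * x + y * y + μ * μ * (M * M)                          ∎
    where
    μx≡ : μ * x ≡ (1ℚ + μ) * y
    μx≡ = trans (sym (ℕ→ℚ-* m (weight m R d))) (trans (cong ℕ→ℚ eq)
            (trans (ℕ→ℚ-* (suc m) (weight m R (suc d))) (cong (_* y) (ℕ→ℚ-+ 1 m))))
  bound (inj₂ (inj₁ (eq , eq′))) rewrite eq | eq′ = ≤-by (square-nonNeg M) (drop′ μ M)
  bound (inj₂ (inj₂ eq)) rewrite eq =
    ≤-by (+-nonNeg (+-nonNeg (square-nonNeg y) (square-nonNeg y)) 0≤μ²M²) (drop″ μ y (μ * μ * (M * M)))

-- The two distances are equal or consecutive, and the bound is symmetric in `x` and `y`.
weight-smooth : ∀ m R {d e} → d ℕ.≤ suc e → e ℕ.≤ suc d →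
  let μ = ℕ→ℚ m; x = ℕ→ℚ (weight m R d); y = ℕ→ℚ (weight m R e); M = ℕ→ℚ (m ℕ.^ R) in
  μ * μ * ((x - y) * (x - y)) ≤ x * x + y * y + μ * μ * (M * M)
weight-smooth m R {d} {e} d≤1+e e≤1+d with ℕ.<-cmp d e
... | tri< d<e _ _ rewrite ℕ.≤-antisym e≤1+d d<e = weight-smooth-step m R d
... | tri≈ _ refl _ = ≤-by (+-nonNeg (+-nonNeg (square-nonNeg x) (square-nonNeg x)) (*-nonNeg (square-nonNeg μ) (square-nonNeg M)))
                        (vanish μ x (x * x + x * x + μ * μ * (M * M)))
  where
  μ = ℕ→ℚ m
  x = ℕ→ℚ (weight m R d)
  M = ℕ→ℚ (m ℕ.^ R)
  vanish : ∀ μ x z → z ≡ μ * μ * ((x - x) * (x - x)) + z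
  vanish = solve-∀ ℚ-ring
... | tri> _ _ e<d rewrite ℕ.≤-antisym d≤1+e e<d = flip (weight-smooth-step m R e)
  where
  μ = ℕ→ℚ m
  x = ℕ→ℚ (weight m R (suc e))
  y = ℕ→ℚ (weight m R e)
  z = μ * μ * (ℕ→ℚ (m ℕ.^ R) * ℕ→ℚ (m ℕ.^ R))
  flip : μ * μ * ((y - x) * (y - x)) ≤ y * y + x * x + z → μ * μ * ((x - y) * (x - y)) ≤ x * x + y * y + z
  flip = subst₂ _≤_ (flipˡ μ y x) (cong (_+ z) (+-comm (y * y) (x * x)))
    where
    flipˡ : ∀ μ y x → μ * μ * ((y - x) * (y - x)) ≡ μ * μ * ((x - y) * (x - y))
    flipˡ = solve-∀ ℚ-ring

-- Approximate normalisation and inner products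

-- Norms may be irrational, so an integer just above serves as the root. For the integer square root
-- `t ≥ T ≥ 3q`, one has `(t + 1)² - t² = 2t + 1 ≤ 3t ≤ t²/q`.
approximate-root : ∀ q T s → 1 ℕ.≤ q → 3 ℕ.* q ℕ.≤ T → T ℕ.* T ℕ.≤ s →
                   ∃[ t ] (s ℕ.≤ suc t ℕ.* suc t × q ℕ.* (suc t ℕ.* suc t) ℕ.≤ suc q ℕ.* s)
approximate-root q T s 1≤q 3q≤T T²≤s with t , t²≤s , s<[1+t]² ← sqrt s = t , ℕ.<⇒≤ s<[1+t]² , (begin
  q ℕ.* (suc t ℕ.* suc t)                        ≡⟨ expand q t ⟩
  q ℕ.* (t ℕ.* t) ℕ.+ q ℕ.* (1 ℕ.+ 2 ℕ.* t)
    ≤⟨ ℕ.+-monoʳ-≤ (q ℕ.* (t ℕ.* t)) (ℕ.*-monoʳ-≤ q (ℕ.+-monoˡ-≤ (2 ℕ.* t) 1≤t)) ⟩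
  q ℕ.* (t ℕ.* t) ℕ.+ q ℕ.* (t ℕ.+ 2 ℕ.* t)      ≡⟨ cong (q ℕ.* (t ℕ.* t) ℕ.+_) (regroup q t) ⟩
  q ℕ.* (t ℕ.* t) ℕ.+ (3 ℕ.* q) ℕ.* t            ≤⟨ ℕ.+-monoʳ-≤ (q ℕ.* (t ℕ.* t)) (ℕ.*-monoˡ-≤ t 3q≤t) ⟩
  q ℕ.* (t ℕ.* t) ℕ.+ t ℕ.* t                    ≡⟨ ℕ.+-comm (q ℕ.* (t ℕ.* t)) (t ℕ.* t) ⟩
  suc q ℕ.* (t ℕ.* t)                            ≤⟨ ℕ.*-monoʳ-≤ (suc q) t²≤s ⟩
  suc q ℕ.* s                                    ∎)
  where
  open ℕ.≤-Reasoning
  open +-*-Solver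
  expand : ∀ q t → q ℕ.* (suc t ℕ.* suc t) ≡ q ℕ.* (t ℕ.* t) ℕ.+ q ℕ.* (1 ℕ.+ 2 ℕ.* t)
  expand = solve 2 (λ q t → q :* ((con 1 :+ t) :* (con 1 :+ t)) := q :* (t :* t) :+ q :* (con 1 :+ con 2 :* t)) refl
  regroup : ∀ q t → q ℕ.* (t ℕ.+ 2 ℕ.* t) ≡ (3 ℕ.* q) ℕ.* t
  regroup = solve 2 (λ q t → q :* (t :+ con 2 :* t) := (con 3 :* q) :* t) refl
  3q≤t : 3 ℕ.* q ℕ.≤ t
  3q≤t = ℕ.≤-trans 3q≤T (ℕ.s≤s⁻¹ (square-cancel-< (ℕ.≤-<-trans T²≤s s<[1+t]²)))
  1≤t : 1 ℕ.≤ t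
  1≤t = ℕ.≤-trans (ℕ.≤-trans 1≤q (ℕ.m≤n*m q 3)) 3q≤t

-- S and S′ are the squared norms and P the inner product of two vectors, so that S + S′ - 2P is
-- their squared distance; s and s′ approximate √S and √S′ from above.
normalised-inner-product : ∀ (Q S S′ P s s′ g g′ η : ℚ) →
  1ℚ + 1ℚ ≤ Q → g * s ≡ 1ℚ → g′ * s′ ≡ 1ℚ → 0ℚ ≤ g → 0ℚ ≤ g′ →
  Q * (s * s) ≤ (1ℚ + Q) * S → Q * (s′ * s′) ≤ (1ℚ + Q) * S′ →
  Q * (S + S′ - (P + P)) ≤ (S + S′) + (S + S′) →
  1ℚ + 1ℚ + 1ℚ ≤ η * (1ℚ + Q) →
  1ℚ - η ≤ g * g′ * P
normalised-inner-product Q S S′ P s s′ g g′ η 2≤Q gs≡1 g′s′≡1 0≤g 0≤g′ Qs²≤ Qs′²≤ QD≤ 3≤ =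
  -- The hypothesis on `η` says `(1 + Q)(1 - η) ≤ Q - 2`. As `g` and `g′` invert `s` and `s′`, it
  -- remains to compare `(Q - 2) s s′` with `(1 + Q) P`.
  *-cancelˡ-≤-pos (1ℚ + Q) {{positive 0<1+Q}} (begin
    (1ℚ + Q) * (1ℚ - η)                    ≤⟨ ≤-by (0≤y-x 3≤) (id₁ Q η) ⟩
    Q - (1ℚ + 1ℚ)                          ≡⟨ one (Q - (1ℚ + 1ℚ)) ⟩
    (Q - (1ℚ + 1ℚ)) * (1ℚ * 1ℚ)            ≡⟨ cong₂ (λ x y → (Q - (1ℚ + 1ℚ)) * (x * y)) gs≡1 g′s′≡1 ⟨
    (Q - (1ℚ + 1ℚ)) * (g * s * (g′ * s′))  ≡⟨ id₂ (Q - (1ℚ + 1ℚ)) g g′ s s′ ⟩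
    g * g′ * ((Q - (1ℚ + 1ℚ)) * (s * s′))  ≤⟨ *-monoˡ-≤ (*-nonNeg 0≤g 0≤g′) main ⟩
    g * g′ * ((1ℚ + Q) * P)                ≡⟨ id₃ (g * g′) Q P ⟩
    (1ℚ + Q) * (g * g′ * P)                ∎)
  where
  open ≤-Reasoning
  two = 1ℚ + 1ℚ
  0<Q : 0ℚ < Q
  0<Q = <-≤-trans (ℕ→ℚ-mono-< {0} {2} (ℕ.s≤s ℕ.z≤n)) 2≤Q
  0<1+Q : 0ℚ < 1ℚ + Q
  0<1+Q = +-mono-< (ℕ→ℚ-mono-< {0} {1} (ℕ.s≤s ℕ.z≤n)) 0<Q
  0<2Q : 0ℚ < two * Q
  0<2Q = subst (_< two * Q) (*-zeroʳ two) (*-monoʳ-<-pos two 0<Q)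
  id₁ : ∀ Q η → Q - (1ℚ + 1ℚ) ≡ (1ℚ + Q) * (1ℚ - η) + (η * (1ℚ + Q) - (1ℚ + 1ℚ + 1ℚ))
  id₁ = solve-∀ ℚ-ring
  one : ∀ x → x ≡ x * (1ℚ * 1ℚ)
  one = solve-∀ ℚ-ring
  id₂ : ∀ x g g′ s s′ → x * (g * s * (g′ * s′)) ≡ g * g′ * (x * (s * s′))
  id₂ = solve-∀ ℚ-ring
  id₃ : ∀ x Q P → x * ((1ℚ + Q) * P) ≡ (1ℚ + Q) * (x * P)
  id₃ = solve-∀ ℚ-ring
  id₄ : ∀ Q x s s′ → Q * x * (s * s + s′ * s′) ≡ (1ℚ + 1ℚ) * Q * (x * (s * s′)) + Q * x * ((s - s′) * (s - s′))
  id₄ = solve-∀ ℚ-ring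
  id₅ : ∀ Q x s s′ → Q * x * (s * s + s′ * s′) ≡ x * (Q * (s * s) + Q * (s′ * s′))
  id₅ = solve-∀ ℚ-ring
  id₆ : ∀ Q S S′ P → (1ℚ + 1ℚ) * Q * ((1ℚ + Q) * P) ≡
        (Q - (1ℚ + 1ℚ)) * ((1ℚ + Q) * S + (1ℚ + Q) * S′) +
        (1ℚ + Q) * ((S + S′) + (S + S′) - Q * (S + S′ - (P + P)))
  id₆ = solve-∀ ℚ-ring
  -- By `2 s s′ ≤ s² + s′²` the roots enter only squared, where they are within `1 + 1/Q` of `S` and
  -- `S′`; the distance bound amounts to `(Q - 2)(S + S′) ≤ 2 Q P`.
  main : (Q - two) * (s * s′) ≤ (1ℚ + Q) * P
  main = *-cancelˡ-≤-pos (two * Q) {{positive 0<2Q}} (begin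
    two * Q * ((Q - two) * (s * s′))
      ≤⟨ ≤-by (*-nonNeg (*-nonNeg (<⇒≤ 0<Q) (0≤y-x 2≤Q)) (square-nonNeg (s - s′))) (id₄ Q (Q - two) s s′) ⟩
    Q * (Q - two) * (s * s + s′ * s′)                ≡⟨ id₅ Q (Q - two) s s′ ⟩
    (Q - two) * (Q * (s * s) + Q * (s′ * s′))        ≤⟨ *-monoˡ-≤ (0≤y-x 2≤Q) (+-mono-≤ Qs²≤ Qs′²≤) ⟩
    (Q - two) * ((1ℚ + Q) * S + (1ℚ + Q) * S′)       ≤⟨ ≤-by (*-nonNeg (<⇒≤ 0<1+Q) (0≤y-x QD≤)) (id₆ Q S S′ P) ⟩
    two * Q * ((1ℚ + Q) * P)                         ∎)

ℕ→ℚ-cancel-≤ : ∀ {a b} → ℕ→ℚ a ≤ ℕ→ℚ b → a ℕ.≤ b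
ℕ→ℚ-cancel-≤ a≤b = ℕ.≮⇒≥ (λ b<a → <-irrefl refl (<-≤-trans (ℕ→ℚ-mono-< b<a) a≤b))

reciprocal : ∀ t → ∃[ g ] (g * ℕ→ℚ (suc t) ≡ 1ℚ × 0ℚ ≤ g)
reciprocal t = (1/ p) {{p≢0}} , *-inverseˡ p {{p≢0}} , <⇒≤ (positive⁻¹ ((1/ p) {{p≢0}}) {{1/pos⇒pos p {{p>0}}}})
  where
  p = ℕ→ℚ (suc t)
  p>0 = positive (ℕ→ℚ-mono-< (ℕ.s≤s (ℕ.z≤n {t})))
  p≢0 = pos⇒nonZero p {{p>0}}


module _ {n} (a : Fin n → Fin n → ℚ) where

  inner : Fin n → Fin n → ℚ
  inner u v = sum (λ c → a c u * a c v)

  rescale-inner : ∀ (g : Fin n → ℚ) u v →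
                  sum (λ c → (g u * a c u) * (g v * a c v)) ≡ g u * g v * inner u v
  rescale-inner g u v = trans (sum-cong-≗ (λ c → regroup (g u) (g v) (a c u) (a c v)))
                              (sym (*-distribˡ-sum (g u * g v) (λ c → a c u * a c v)))
    where
    regroup : ∀ g g′ x y → g * x * (g′ * y) ≡ g * g′ * (x * y)
    regroup = solve-∀ ℚ-ring

  polarisation : ∀ u v → sum (λ c → (a c u - a c v) * (a c u - a c v)) ≡
                         inner u u + inner v v - (inner u v + inner u v)
  polarisation u v = move (begin
    sum (λ c → (a c u - a c v) * (a c u - a c v)) + (inner u v + inner u v)
      ≡⟨ cong (sum (λ c → (a c u - a c v) * (a c u - a c v)) +_) (∑-distrib-+ (λ c → a c u * a c v) (λ c → a c u * a c v)) ⟨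
    sum (λ c → (a c u - a c v) * (a c u - a c v)) + sum (λ c → a c u * a c v + a c u * a c v)
      ≡⟨ ∑-distrib-+ (λ c → (a c u - a c v) * (a c u - a c v)) (λ c → a c u * a c v + a c u * a c v) ⟨
    sum (λ c → (a c u - a c v) * (a c u - a c v) + (a c u * a c v + a c u * a c v))
      ≡⟨ sum-cong-≗ (λ c → double (a c u) (a c v)) ⟩
    sum (λ c → a c u * a c u + a c v * a c v)
      ≡⟨ ∑-distrib-+ (λ c → a c u * a c u) (λ c → a c v * a c v) ⟩
    inner u u + inner v v ∎)
    where
    open ≡-Reasoning
    double : ∀ x y → (x - y) * (x - y) + (x * y + x * y) ≡ x * x + y * y
    double = solve-∀ ℚ-ring
    cancel : ∀ x y → x ≡ x + y - y
    cancel = solve-∀ ℚ-ring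
    move : ∀ {x y z} → x + y ≡ z → x ≡ z - y
    move {x} {y} eq = trans (cancel x y) (cong (_- y) eq)

  -- Summed over `c`, the pointwise bounds leave the error `n Z`, which a second copy of the squared
  -- norms absorbs.
  smooth⇒close : ∀ Q Z T {u v} → 0ℚ ≤ Q →
    (∀ c → Q * ((a c u - a c v) * (a c u - a c v)) ≤ a c u * a c u + a c v * a c v + Z) →
    ℕ→ℚ n * Z ≤ T → T ≤ inner u u →
    Q * (inner u u + inner v v - (inner u v + inner u v)) ≤
    (inner u u + inner v v) + (inner u u + inner v v)
  smooth⇒close Q Z T {u} {v} 0≤Q smooth nZ≤T T≤ = begin
    Q * (inner u u + inner v v - (inner u v + inner u v))
      ≡⟨ cong (Q *_) (polarisation u v) ⟨
    Q * sum (λ c → (a c u - a c v) * (a c u - a c v))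
      ≡⟨ *-distribˡ-sum Q (λ c → (a c u - a c v) * (a c u - a c v)) ⟩
    sum (λ c → Q * ((a c u - a c v) * (a c u - a c v)))
      ≤⟨ sum-mono {f = λ c → Q * ((a c u - a c v) * (a c u - a c v))} {λ c → a c u * a c u + a c v * a c v + Z} smooth ⟩
    sum (λ c → a c u * a c u + a c v * a c v + Z)
      ≡⟨ ∑-distrib-+ (λ c → a c u * a c u + a c v * a c v) (λ _ → Z) ⟩
    sum (λ c → a c u * a c u + a c v * a c v) + sum {n} (λ _ → Z)
      ≡⟨ cong₂ _+_ (∑-distrib-+ (λ c → a c u * a c u) (λ c → a c v * a c v)) (sum-const Z) ⟩
    inner u u + inner v v + ℕ→ℚ n * Z
      ≤⟨ +-monoʳ-≤ (inner u u + inner v v) nZ≤T ⟩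
    inner u u + inner v v + T
      ≤⟨ +-monoʳ-≤ (inner u u + inner v v) (≤-trans T≤ (≤-by {inner u u} (sum-nonNeg {f = λ c → a c v * a c v} (λ c → square-nonNeg (a c v))) refl)) ⟩
    inner u u + inner v v + (inner u u + inner v v) ∎
    where
    open ≤-Reasoning
    sum-const : ∀ Z → sum {n} (λ _ → Z) ≡ ℕ→ℚ n * Z
    sum-const Z = trans (sum-cong-≗ {n} (λ _ → sym (*-identityʳ Z)))
      (trans (sym (*-distribˡ-sum Z (λ (_ : Fin n) → 1ℚ))) (trans (cong (Z *_) (sum-one n)) (*-comm Z (ℕ→ℚ n))))

squaredNorm-ℕ : ∀ {n} (f : Fin n → ℕ) → ∃[ s ] (sum (λ c → ℕ→ℚ (f c) * ℕ→ℚ (f c)) ≡ ℕ→ℚ s)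
squaredNorm-ℕ f = proj₁ s , trans (sum-cong-≗ (λ c → sym (ℕ→ℚ-* (f c) (f c)))) (proj₂ s)
  where s = sum-ℕ→ℚ (λ c → f c ℕ.* f c)

-- The single entry `f c` already makes the squared norm at least `T²`, as `approximate-root`
-- requires.
norm-root : ∀ {n} q T (f : Fin n → ℕ) c → 1 ℕ.≤ q → 3 ℕ.* q ℕ.≤ T → T ℕ.≤ f c →
            let S = sum (λ c → ℕ→ℚ (f c) * ℕ→ℚ (f c)) in
            ∃[ t ] (S ≤ ℕ→ℚ (suc t) * ℕ→ℚ (suc t)
                    × ℕ→ℚ q * (ℕ→ℚ (suc t) * ℕ→ℚ (suc t)) ≤ (1ℚ + ℕ→ℚ q) * S)
norm-root q T f c 1≤q 3q≤T T≤fc = t , S≤ , ≤S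
  where
  s = proj₁ (squaredNorm-ℕ f)
  S≡s = proj₂ (squaredNorm-ℕ f)
  T²≤s : T ℕ.* T ℕ.≤ s
  T²≤s = ℕ.≤-trans (ℕ.*-mono-≤ T≤fc T≤fc) (ℕ→ℚ-cancel-≤ (subst₂ _≤_ (sym (ℕ→ℚ-* (f c) (f c))) S≡s
    (term≤sum {f = λ c → ℕ→ℚ (f c) * ℕ→ℚ (f c)} (λ c → square-nonNeg (ℕ→ℚ (f c))) c)))
  t-spec = approximate-root q T s 1≤q 3q≤T T²≤s
  t = proj₁ t-spec
  S≤ = subst₂ _≤_ (sym S≡s) (ℕ→ℚ-* (suc t) (suc t)) (ℕ→ℚ-mono-≤ {s} {suc t ℕ.* suc t} (proj₁ (proj₂ t-spec)))
  ≤S = subst₂ _≤_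
    (trans (ℕ→ℚ-* q (suc t ℕ.* suc t)) (cong (ℕ→ℚ q *_) (ℕ→ℚ-* (suc t) (suc t))))
    (trans (ℕ→ℚ-* (suc q) s) (cong₂ _*_ (ℕ→ℚ-+ 1 q) (sym S≡s)))
    (ℕ→ℚ-mono-≤ {q ℕ.* (suc t ℕ.* suc t)} {suc q ℕ.* s} (proj₂ (proj₂ t-spec)))

-- In the application `q` is `m²`, `T` is the weight `(m + 1)^R` at the centre and `Z` is the
-- cut-off error `m² (m^R)²`.
module _ {n} (w : Fin n → Fin n → ℕ) (q T Z : ℕ) (2≤q : 2 ℕ.≤ q) (3q≤T : 3 ℕ.* q ℕ.≤ T)
         (T≤w : ∀ v → T ℕ.≤ w v v) (nZ≤T² : n ℕ.* Z ℕ.≤ T ℕ.* T) where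

  private
    a : Fin n → Fin n → ℚ
    a c v = ℕ→ℚ (w c v)

    S : Fin n → Fin n → ℚ
    S = inner a

    root : ∀ v → ∃[ t ] (S v v ≤ ℕ→ℚ (suc t) * ℕ→ℚ (suc t)
                         × ℕ→ℚ q * (ℕ→ℚ (suc t) * ℕ→ℚ (suc t)) ≤ (1ℚ + ℕ→ℚ q) * S v v)
    root v = norm-root q T (λ c → w c v) v (ℕ.<⇒≤ 2≤q) 3q≤T (T≤w v)

    σ : Fin n → ℚ
    σ v = ℕ→ℚ (suc (proj₁ (root v)))

    S≤σ² : ∀ v → S v v ≤ σ v * σ v
    S≤σ² v = proj₁ (proj₂ (root v))

    qσ²≤ : ∀ v → ℕ→ℚ q * (σ v * σ v) ≤ (1ℚ + ℕ→ℚ q) * S v v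
    qσ²≤ v = proj₂ (proj₂ (root v))

    scale : ∀ v → ∃[ g ] (g * σ v ≡ 1ℚ × 0ℚ ≤ g)
    scale v = reciprocal (proj₁ (root v))

  scaledWeight : Fin n → Fin n → ℚ
  scaledWeight c v = proj₁ (scale v) * a c v

  scaledWeight-nonNeg : ∀ c v → 0ℚ ≤ scaledWeight c v
  scaledWeight-nonNeg c v = *-nonNeg (proj₂ (proj₂ (scale v))) (0≤ℕ→ℚ (w c v))

  scaledWeight-zero : ∀ c v → w c v ≡ 0 → scaledWeight c v ≡ 0ℚ
  scaledWeight-zero c v w≡0 = trans (cong (λ x → proj₁ (scale v) * ℕ→ℚ x) w≡0) (*-zeroʳ (proj₁ (scale v)))

  scaledWeight-norm : ∀ v → sum (λ c → scaledWeight c v * scaledWeight c v) ≤ 1ℚ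
  scaledWeight-norm v = ≤-trans (≤-reflexive (rescale-inner a (λ v → proj₁ (scale v)) v v))
    (bound (proj₁ (scale v)) (σ v) (S v v) (proj₁ (proj₂ (scale v))) (S≤σ² v))
    where
    open ≤-Reasoning
    regroup : ∀ g σ → g * g * (σ * σ) ≡ g * σ * (g * σ)
    regroup = solve-∀ ℚ-ring
    bound : ∀ g σ S → g * σ ≡ 1ℚ → S ≤ σ * σ → g * g * S ≤ 1ℚ
    bound g σ S gσ≡1 S≤σ² = begin
      g * g * S          ≤⟨ *-monoˡ-≤ (square-nonNeg g) S≤σ² ⟩
      g * g * (σ * σ)    ≡⟨ regroup g σ ⟩
      g * σ * (g * σ)    ≡⟨ cong₂ _*_ gσ≡1 gσ≡1 ⟩
      1ℚ * 1ℚ            ≡⟨ *-identityˡ 1ℚ ⟩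
      1ℚ                 ∎

  scaledWeight-close : ∀ η → 1ℚ + 1ℚ + 1ℚ ≤ η * (1ℚ + ℕ→ℚ q) → ∀ u v →
    (∀ c → ℕ→ℚ q * ((a c u - a c v) * (a c u - a c v)) ≤ a c u * a c u + a c v * a c v + ℕ→ℚ Z) →
    1ℚ - η ≤ sum (λ c → scaledWeight c u * scaledWeight c v)
  scaledWeight-close η 3≤ u v smooth = ≤-trans
    (normalised-inner-product (ℕ→ℚ q) (S u u) (S v v) (S u v) (σ u) (σ v) (proj₁ (scale u)) (proj₁ (scale v)) η
      (ℕ→ℚ-mono-≤ {2} {q} 2≤q)
      (proj₁ (proj₂ (scale u))) (proj₁ (proj₂ (scale v))) (proj₂ (proj₂ (scale u))) (proj₂ (proj₂ (scale v)))
      (qσ²≤ u) (qσ²≤ v)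
      (smooth⇒close a (ℕ→ℚ q) (ℕ→ℚ Z) (ℕ→ℚ T * ℕ→ℚ T) {u} {v} (0≤ℕ→ℚ q) smooth nZ≤T²ℚ T²≤S)
      3≤)
    (≤-reflexive (sym (rescale-inner a (λ v → proj₁ (scale v)) u v)))
    where
    nZ≤T²ℚ : ℕ→ℚ n * ℕ→ℚ Z ≤ ℕ→ℚ T * ℕ→ℚ T
    nZ≤T²ℚ = subst₂ _≤_ (ℕ→ℚ-* n Z) (ℕ→ℚ-* T T) (ℕ→ℚ-mono-≤ {n ℕ.* Z} {T ℕ.* T} nZ≤T²)
    T²≤S : ℕ→ℚ T * ℕ→ℚ T ≤ S u u
    T²≤S = ≤-trans (*-mono-≤ (0≤ℕ→ℚ T) (0≤ℕ→ℚ T) (ℕ→ℚ-mono-≤ {T} {w u u} (T≤w u)) (ℕ→ℚ-mono-≤ {T} {w u u} (T≤w u)))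
                   (term≤sum {f = λ c → a c u * a c u} (λ c → square-nonNeg (a c u)) u)

-- The interface between weights and local colourings: by `support`, a colouring of the ball around
-- `c` is consulted only on edges inside that ball.
record SmoothWeights {n} (G : Graph n) (R : ℕ) (η : ℚ) : Set where
  field
    h       : Fin n → Fin n → ℚ
    nonNeg  : ∀ c v → 0ℚ ≤ h c v
    norm    : ∀ v → sum (λ c → h c v * h c v) ≤ 1ℚ
    support : ∀ {u v} → E G u v → ∀ c → h c u * h c v ≡ 0ℚ ⊎ E (ball G R c) u v
    close   : ∀ {u v} → E G u v → 1ℚ - η ≤ sum (λ c → h c u * h c v)

smoothWeights : ∀ {n} (G : Graph n) → (∀ v → v ∈ V G) → ∀ m R η → 2 ℕ.≤ m →
  3 ℕ.* (m ℕ.* m) ℕ.≤ suc m ℕ.^ R →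
  n ℕ.* ((m ℕ.* m) ℕ.* (m ℕ.^ R ℕ.* m ℕ.^ R)) ℕ.≤ suc m ℕ.^ R ℕ.* suc m ℕ.^ R →
  1ℚ + 1ℚ + 1ℚ ≤ η * (1ℚ + ℕ→ℚ (m ℕ.* m)) →
  SmoothWeights G R η
smoothWeights {n} G full m R η 2≤m 3m²≤ far 3≤ = record
  { h       = scaledWeight w q T Z 2≤q 3m²≤ T≤w far
  ; nonNeg  = scaledWeight-nonNeg w q T Z 2≤q 3m²≤ T≤w far
  ; norm    = scaledWeight-norm w q T Z 2≤q 3m²≤ T≤w far
  ; support = support
  ; close   = λ {u} {v} e → scaledWeight-close w q T Z 2≤q 3m²≤ T≤w far η 3≤ u v (smooth e)
  }
  where
  q = m ℕ.* m
  T = suc m ℕ.^ R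
  Z = q ℕ.* (m ℕ.^ R ℕ.* m ℕ.^ R)
  D : Fin n → Fin n → ℕ
  D = truncatedDistance G R
  w : Fin n → Fin n → ℕ
  w c v = weight m R (D c v)
  2≤q : 2 ℕ.≤ q
  2≤q = ℕ.≤-trans 2≤m (ℕ.m≤m*n m m {{ℕ.>-nonZero (ℕ.<⇒≤ 2≤m)}})
  T≤w : ∀ v → T ℕ.≤ w v v
  T≤w v = ℕ.≤-reflexive (cong (weight m R) (sym (truncatedDistance-self G R (full v))))

  support : ∀ {u v} → E G u v → ∀ c →
            scaledWeight w q T Z 2≤q 3m²≤ T≤w far c u * scaledWeight w q T Z 2≤q 3m²≤ T≤w far c v ≡ 0ℚ ⊎ E (ball G R c) u v
  support {u} {v} e c = cases (ℕ.≤-<-connex (D c u) R) (ℕ.≤-<-connex (D c v) R)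
    where
    h = scaledWeight w q T Z 2≤q 3m²≤ T≤w far
    vanish : ∀ v → R ℕ.< D c v → h c v ≡ 0ℚ
    vanish v R<d = scaledWeight-zero w q T Z 2≤q 3m²≤ T≤w far c v (weight-outside m R<d)
    cases : _ → _ → h c u * h c v ≡ 0ℚ ⊎ E (ball G R c) u v
    cases (inj₁ u≤R) (inj₁ v≤R) = inj₂ (e , truncatedDistance≤⇒∈ball G R u≤R , truncatedDistance≤⇒∈ball G R v≤R)
    cases (inj₂ R<u) _          = inj₁ (trans (cong (_* h c v) (vanish u R<u)) (*-zeroˡ (h c v)))
    cases _          (inj₂ R<v) = inj₁ (trans (cong (h c u *_) (vanish v R<v)) (*-zeroʳ (h c u)))

  smooth : ∀ {u v} → E G u v → ∀ c →
           ℕ→ℚ q * ((ℕ→ℚ (w c u) - ℕ→ℚ (w c v)) * (ℕ→ℚ (w c u) - ℕ→ℚ (w c v))) ≤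
           ℕ→ℚ (w c u) * ℕ→ℚ (w c u) + ℕ→ℚ (w c v) * ℕ→ℚ (w c v) + ℕ→ℚ Z
  smooth {u} {v} e c = rewrite-Q (ℕ→ℚ (w c u)) (ℕ→ℚ (w c v))
    (weight-smooth m R {D c u} {D c v} (truncatedDistance-lipschitz G R c e) (truncatedDistance-lipschitz G R c (E-sym G e)))
    where
    M = ℕ→ℚ (m ℕ.^ R)
    Q≡ : ℕ→ℚ q ≡ ℕ→ℚ m * ℕ→ℚ m
    Q≡ = ℕ→ℚ-* m m
    Z≡ : ℕ→ℚ Z ≡ ℕ→ℚ m * ℕ→ℚ m * (M * M)
    Z≡ = trans (ℕ→ℚ-* q (m ℕ.^ R ℕ.* m ℕ.^ R)) (cong₂ _*_ Q≡ (ℕ→ℚ-* (m ℕ.^ R) (m ℕ.^ R)))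
    rewrite-Q : ∀ x y → ℕ→ℚ m * ℕ→ℚ m * ((x - y) * (x - y)) ≤ x * x + y * y + ℕ→ℚ m * ℕ→ℚ m * (M * M) →
                ℕ→ℚ q * ((x - y) * (x - y)) ≤ x * x + y * y + ℕ→ℚ Z
    rewrite-Q x y = subst₂ (λ Q Z → Q * ((x - y) * (x - y)) ≤ x * x + y * y + Z) (sym Q≡) (sym Z≡)

-- The choice of m and R

module _ where
  open ℕ.≤-Reasoning

  -- Bernoulli's inequality `(1 + 1/m)^j ≥ 1 + j/m`, cleared of denominators.
  bernoulli : ∀ m j → m ℕ.^ j ℕ.* (m ℕ.+ j) ℕ.≤ suc m ℕ.^ j ℕ.* m
  bernoulli m zero = ℕ.≤-reflexive (cong (1 ℕ.*_) (ℕ.+-identityʳ m))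
  bernoulli m (suc j) = begin
    m ℕ.* m ℕ.^ j ℕ.* (m ℕ.+ suc j)          ≤⟨ ℕ.m≤m+n _ (m ℕ.^ j ℕ.* j) ⟩
    m ℕ.* m ℕ.^ j ℕ.* (m ℕ.+ suc j) ℕ.+ m ℕ.^ j ℕ.* j
                                             ≡⟨ regroup m (m ℕ.^ j) j ⟩
    suc m ℕ.* (m ℕ.^ j ℕ.* (m ℕ.+ j))        ≤⟨ ℕ.*-monoʳ-≤ (suc m) (bernoulli m j) ⟩
    suc m ℕ.* (suc m ℕ.^ j ℕ.* m)            ≡⟨ ℕ.*-assoc (suc m) (suc m ℕ.^ j) m ⟨
    suc m ℕ.* suc m ℕ.^ j ℕ.* m              ∎
    where
    open +-*-Solver
    regroup : ∀ m p j → m ℕ.* p ℕ.* (m ℕ.+ suc j) ℕ.+ p ℕ.* j ≡ suc m ℕ.* (p ℕ.* (m ℕ.+ j))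
    regroup = solve 3 (λ m p j → m :* p :* (m :+ (con 1 :+ j)) :+ p :* j := (con 1 :+ m) :* (p :* (m :+ j))) refl

  2*m^m≤ : ∀ m → 1 ℕ.≤ m → 2 ℕ.* m ℕ.^ m ℕ.≤ suc m ℕ.^ m
  2*m^m≤ m 1≤m = ℕ.*-cancelʳ-≤ _ _ m {{ℕ.>-nonZero 1≤m}} (begin
    2 ℕ.* m ℕ.^ m ℕ.* m      ≡⟨ regroup m (m ℕ.^ m) ⟩
    m ℕ.^ m ℕ.* (m ℕ.+ m)    ≤⟨ bernoulli m m ⟩
    suc m ℕ.^ m ℕ.* m        ∎)
    where
    open +-*-Solver
    regroup : ∀ m p → 2 ℕ.* p ℕ.* m ≡ p ℕ.* (m ℕ.+ m)
    regroup = solve 2 (λ m p → con 2 :* p :* m := p :* (m :+ m)) refl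

  *-^ : ∀ p a b → (a ℕ.* b) ℕ.^ p ≡ a ℕ.^ p ℕ.* b ℕ.^ p
  *-^ zero    a b = refl
  *-^ (suc p) a b = trans (cong (a ℕ.* b ℕ.*_) (*-^ p a b)) (regroup a b (a ℕ.^ p) (b ℕ.^ p))
    where
    open +-*-Solver
    regroup : ∀ a b x y → a ℕ.* b ℕ.* (x ℕ.* y) ≡ a ℕ.* x ℕ.* (b ℕ.* y)
    regroup = solve 4 (λ a b x y → a :* b :* (x :* y) := a :* x :* (b :* y)) refl

  -- At radius `m p` the weight at the rim is thus at most `2^(-p)` times the weight at the centre.
  2^p*m^mp≤ : ∀ m p → 1 ℕ.≤ m → 2 ℕ.^ p ℕ.* m ℕ.^ (m ℕ.* p) ℕ.≤ suc m ℕ.^ (m ℕ.* p)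
  2^p*m^mp≤ m p 1≤m = begin
    2 ℕ.^ p ℕ.* m ℕ.^ (m ℕ.* p)    ≡⟨ cong (2 ℕ.^ p ℕ.*_) (ℕ.^-*-assoc m m p) ⟨
    2 ℕ.^ p ℕ.* (m ℕ.^ m) ℕ.^ p    ≡⟨ *-^ p 2 (m ℕ.^ m) ⟨
    (2 ℕ.* m ℕ.^ m) ℕ.^ p          ≤⟨ ℕ.^-monoˡ-≤ p (2*m^m≤ m 1≤m) ⟩
    (suc m ℕ.^ m) ℕ.^ p            ≡⟨ ℕ.^-*-assoc (suc m) m p ⟩
    suc m ℕ.^ (m ℕ.* p)            ∎

  n<2^n : ∀ n → n ℕ.< 2 ℕ.^ n
  n<2^n zero = ℕ.s≤s ℕ.z≤n
  n<2^n (suc n) = begin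
    suc (suc n)              ≤⟨ ℕ.+-mono-≤ (ℕ.s≤s (ℕ.z≤n {n})) (n<2^n n) ⟩
    suc n ℕ.+ 2 ℕ.^ n        ≤⟨ ℕ.+-monoˡ-≤ (2 ℕ.^ n) (n<2^n n) ⟩
    2 ℕ.^ n ℕ.+ 2 ℕ.^ n      ≡⟨ cong (2 ℕ.^ n ℕ.+_) (ℕ.+-identityʳ (2 ℕ.^ n)) ⟨
    2 ℕ.^ suc n              ∎

  [1+t]²≤4t² : ∀ {t} → 1 ℕ.≤ t → suc t ℕ.* suc t ℕ.≤ 4 ℕ.* (t ℕ.* t)
  [1+t]²≤4t² {t} 1≤t = begin
    suc t ℕ.* suc t              ≤⟨ ℕ.*-mono-≤ (ℕ.+-monoˡ-≤ t 1≤t) (ℕ.+-monoˡ-≤ t 1≤t) ⟩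
    (t ℕ.+ t) ℕ.* (t ℕ.+ t)      ≡⟨ solve 1 (λ t → (t :+ t) :* (t :+ t) := con 4 :* (t :* t)) refl t ⟩
    4 ℕ.* (t ℕ.* t)              ∎
    where open +-*-Solver

-- The excess s = δ N over N = rᵏ, and roundings u, v, l of √(N/s) = δ^(-1/2), √k and log₂ r.
record Parameters (r k N s : ℕ) : Set where
  field
    u v l  : ℕ
    1≤u    : 1 ℕ.≤ u
    1≤v    : 1 ℕ.≤ v
    1≤l    : 1 ℕ.≤ l
    u²s≤N  : u ℕ.* u ℕ.* s ℕ.≤ N
    N≤4u²s : N ℕ.≤ 4 ℕ.* (u ℕ.* u) ℕ.* s
    v²≤k   : v ℕ.* v ℕ.≤ k
    k≤4v²  : k ℕ.≤ 4 ℕ.* (v ℕ.* v)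
    2^l≤r  : 2 ℕ.^ l ℕ.≤ r
    r≤2^2l : r ℕ.≤ 2 ℕ.^ (l ℕ.+ l)

parameters : ∀ {r k N s} → 2 ℕ.≤ r → 1 ℕ.≤ k → 1 ℕ.≤ s → s ℕ.≤ N → Parameters r k N s
parameters {r} {k} {N} {s} 2≤r 1≤k 1≤s s≤N
  -- Each search is for the predecessor, so that the rounded value is at least 1; `s ≤ N`, `1 ≤ k`
  -- and `2 ≤ r` start the three searches.
  with u , u²s≤N , u-max ← last-before (λ u → suc u ℕ.* suc u ℕ.* s ℕ.≤? N) (subst (ℕ._≤ N) (sym (ℕ.*-identityˡ s)) s≤N) N
      (ℕ.<⇒≱ (ℕ.≤-trans (ℕ.m≤m*n (suc N) (suc N)) (ℕ.m≤m*n (suc N ℕ.* suc N) s {{ℕ.>-nonZero 1≤s}})))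
  with v , v²≤k , v-max ← last-before (λ v → suc v ℕ.* suc v ℕ.≤? k) 1≤k k
      (ℕ.<⇒≱ (ℕ.m≤m*n (suc k) (suc k)))
  with l , 2^l≤r , l-max ← last-before (λ l → 2 ℕ.^ suc l ℕ.≤? r) 2≤r r
      (ℕ.<⇒≱ (ℕ.<-trans (n<2^n r) (ℕ.^-monoʳ-< 2 (ℕ.s≤s (ℕ.s≤s ℕ.z≤n)) (ℕ.n<1+n r))))
  = record
  { u = suc u ; v = suc v ; l = suc l
  ; 1≤u = ℕ.s≤s ℕ.z≤n ; 1≤v = ℕ.s≤s ℕ.z≤n ; 1≤l = ℕ.s≤s ℕ.z≤n
  ; u²s≤N = u²s≤N
  ; N≤4u²s = ℕ.≤-trans (ℕ.<⇒≤ (ℕ.≰⇒> u-max)) (ℕ.*-monoˡ-≤ s ([1+t]²≤4t² {suc u} (ℕ.s≤s ℕ.z≤n)))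
  ; v²≤k = v²≤k
  ; k≤4v² = ℕ.≤-trans (ℕ.<⇒≤ (ℕ.≰⇒> v-max)) ([1+t]²≤4t² {suc v} (ℕ.s≤s ℕ.z≤n))
  ; 2^l≤r = 2^l≤r
  ; r≤2^2l = ℕ.≤-trans (ℕ.<⇒≤ (ℕ.≰⇒> l-max)) (ℕ.^-monoʳ-≤ 2 {suc (suc l)} {suc l ℕ.+ suc l} (ℕ.s≤s (ℕ.m≤n+m (suc l) l)))
  }

module Radius {r k s : ℕ} (1≤k : 1 ℕ.≤ k) (2≤r : 2 ℕ.≤ r) (1≤s : 1 ℕ.≤ s) (s≤N : s ℕ.≤ r ℕ.^ k)
              (params : Parameters r k (r ℕ.^ k) s) where
  open Parameters params
  open ℕ.≤-Reasoning
  open +-*-Solver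

  N n m R : ℕ
  N = r ℕ.^ k
  n = N ℕ.+ s
  -- `u v` rounds `√(k/δ)`; the factor 16 outweighs the rounding losses and gives `k/m² ≤ δ/16`.
  m = 16 ℕ.* (u ℕ.* v)
  -- With `X = 2^(l k)`, the rim weight is at most `X^(-8)` times the central one, and `X^16`
  -- exceeds `n m²`.
  R = m ℕ.* (8 ℕ.* (l ℕ.* k))

  1≤uv : 1 ℕ.≤ u ℕ.* v
  1≤uv = ℕ.*-mono-≤ 1≤u 1≤v

  2≤m : 2 ℕ.≤ m
  2≤m = ℕ.*-mono-≤ {2} {16} (ℕ.s≤s (ℕ.s≤s ℕ.z≤n)) 1≤uv

  1≤lk : 1 ℕ.≤ l ℕ.* k
  1≤lk = ℕ.*-mono-≤ 1≤l 1≤k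

  3m²≤[1+m]^R : 3 ℕ.* (m ℕ.* m) ℕ.≤ suc m ℕ.^ R
  3m²≤[1+m]^R = begin
    3 ℕ.* (m ℕ.* m)            ≤⟨ ℕ.*-mono-≤ (ℕ.s≤s 2≤m) (ℕ.*-mono-≤ (ℕ.n≤1+n m) (ℕ.n≤1+n m)) ⟩
    suc m ℕ.* (suc m ℕ.* suc m)  ≡⟨ cong (λ x → suc m ℕ.* (suc m ℕ.* x)) (ℕ.*-identityʳ (suc m)) ⟨
    suc m ℕ.^ 3
      ≤⟨ ℕ.^-monoʳ-≤ (suc m) (ℕ.≤-trans (ℕ.m≤m+n 3 13) (ℕ.*-mono-≤ {2} {m} {8} 2≤m (ℕ.*-monoʳ-≤ 8 1≤lk))) ⟩
    suc m ℕ.^ R                ∎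

  X : ℕ
  X = 2 ℕ.^ (l ℕ.* k)

  2≤X : 2 ℕ.≤ X
  2≤X = ℕ.^-monoʳ-≤ 2 1≤lk

  N≤X² : N ℕ.≤ X ℕ.* X
  N≤X² = begin
    r ℕ.^ k                      ≤⟨ ℕ.^-monoˡ-≤ k r≤2^2l ⟩
    (2 ℕ.^ (l ℕ.+ l)) ℕ.^ k      ≡⟨ ℕ.^-*-assoc 2 (l ℕ.+ l) k ⟩
    2 ℕ.^ ((l ℕ.+ l) ℕ.* k)      ≡⟨ cong (2 ℕ.^_) (ℕ.*-distribʳ-+ k l l) ⟩
    2 ℕ.^ (l ℕ.* k ℕ.+ l ℕ.* k)  ≡⟨ ℕ.^-distribˡ-+-* 2 (l ℕ.* k) (l ℕ.* k) ⟩
    X ℕ.* X                      ∎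

  k≤N : k ℕ.≤ N
  k≤N = ℕ.≤-trans (ℕ.<⇒≤ (n<2^n k)) (ℕ.^-monoˡ-≤ k 2≤r)

  -- This is where `δ ≥ r^(-k)`, in the form `1 ≤ s`, keeps the logarithm of `m` of order `k log r`.
  u²≤N : u ℕ.* u ℕ.≤ N
  u²≤N = ℕ.≤-trans (ℕ.m≤m*n (u ℕ.* u) s {{ℕ.>-nonZero 1≤s}}) u²s≤N

  nm²≤X^16 : n ℕ.* (m ℕ.* m) ℕ.≤ X ℕ.^ 16
  nm²≤X^16 = begin
    n ℕ.* (m ℕ.* m)
      ≡⟨ cong (n ℕ.*_) (solve 2 (λ u v → (con 16 :* (u :* v)) :* (con 16 :* (u :* v)) := con 256 :* ((u :* u) :* (v :* v))) refl u v) ⟩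
    n ℕ.* (256 ℕ.* ((u ℕ.* u) ℕ.* (v ℕ.* v)))
      ≤⟨ ℕ.*-mono-≤ (ℕ.+-monoʳ-≤ N s≤N) (ℕ.*-monoʳ-≤ 256 (ℕ.*-mono-≤ u²≤N (ℕ.≤-trans v²≤k k≤N))) ⟩
    (N ℕ.+ N) ℕ.* (256 ℕ.* (N ℕ.* N))
      ≡⟨ solve 1 (λ N → (N :+ N) :* (con 256 :* (N :* N)) := con 512 :* (N :* (N :* N))) refl N ⟩
    512 ℕ.* (N ℕ.* (N ℕ.* N))
      ≤⟨ ℕ.*-mono-≤ (ℕ.^-monoˡ-≤ 9 2≤X) (ℕ.*-mono-≤ N≤X² (ℕ.*-mono-≤ N≤X² N≤X²)) ⟩
    X ℕ.^ 9 ℕ.* (X ℕ.* X ℕ.* (X ℕ.* X ℕ.* (X ℕ.* X)))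
      ≡⟨ solve 1 (λ X → X :^ 9 :* (X :* X :* (X :* X :* (X :* X))) := X :^ 15) refl X ⟩
    -- The exponent is made even so that the bound is the square of `X^8`.
    X ℕ.^ 15                                       ≤⟨ ℕ.^-monoʳ-≤ X {{ℕ.>-nonZero (ℕ.<⇒≤ 2≤X)}} (ℕ.n≤1+n 15) ⟩
    X ℕ.^ 16                                       ∎

  far : n ℕ.* ((m ℕ.* m) ℕ.* (m ℕ.^ R ℕ.* m ℕ.^ R)) ℕ.≤ suc m ℕ.^ R ℕ.* suc m ℕ.^ R
  far = begin
    n ℕ.* ((m ℕ.* m) ℕ.* (M ℕ.* M))        ≡⟨ ℕ.*-assoc n (m ℕ.* m) (M ℕ.* M) ⟨
    n ℕ.* (m ℕ.* m) ℕ.* (M ℕ.* M)          ≤⟨ ℕ.*-monoˡ-≤ (M ℕ.* M) nm²≤X^16 ⟩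
    X ℕ.^ 16 ℕ.* (M ℕ.* M)
      ≡⟨ solve 2 (λ X M → X :^ 16 :* (M :* M) := (X :^ 8 :* M) :* (X :^ 8 :* M)) refl X M ⟩
    (X ℕ.^ 8 ℕ.* M) ℕ.* (X ℕ.^ 8 ℕ.* M)    ≤⟨ ℕ.*-mono-≤ X^8M≤ X^8M≤ ⟩
    suc m ℕ.^ R ℕ.* suc m ℕ.^ R            ∎
    where
    M = m ℕ.^ R
    X^8M≤ : X ℕ.^ 8 ℕ.* M ℕ.≤ suc m ℕ.^ R
    X^8M≤ = subst (λ y → y ℕ.* M ℕ.≤ suc m ℕ.^ R)
      (trans (cong (2 ℕ.^_) (ℕ.*-comm 8 (l ℕ.* k))) (sym (ℕ.^-*-assoc 2 (l ℕ.* k) 8)))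
      (2^p*m^mp≤ m (8 ℕ.* (l ℕ.* k)) (ℕ.<⇒≤ 2≤m))

  16k≤m² : 16 ℕ.* k ℕ.≤ m ℕ.* m
  16k≤m² = begin
    16 ℕ.* k                                   ≤⟨ ℕ.*-mono-≤ {16} {64} (ℕ.m≤m+n 16 48) k≤4v² ⟩
    64 ℕ.* (4 ℕ.* (v ℕ.* v))                   ≤⟨ ℕ.m≤m*n _ (u ℕ.* u) {{ℕ.>-nonZero (ℕ.*-mono-≤ 1≤u 1≤u)}} ⟩
    64 ℕ.* (4 ℕ.* (v ℕ.* v)) ℕ.* (u ℕ.* u)
      ≡⟨ solve 2 (λ u v → con 64 :* (con 4 :* (v :* v)) :* (u :* u) := (con 16 :* (u :* v)) :* (con 16 :* (u :* v))) refl u v ⟩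
    m ℕ.* m                                    ∎

  16Nk≤sm² : 16 ℕ.* (N ℕ.* k) ℕ.≤ s ℕ.* (m ℕ.* m)
  16Nk≤sm² = begin
    16 ℕ.* (N ℕ.* k)                                       ≤⟨ ℕ.*-monoʳ-≤ 16 (ℕ.*-mono-≤ N≤4u²s k≤4v²) ⟩
    16 ℕ.* (4 ℕ.* (u ℕ.* u) ℕ.* s ℕ.* (4 ℕ.* (v ℕ.* v)))
      ≡⟨ solve 3 (λ u v s → con 16 :* (con 4 :* (u :* u) :* s :* (con 4 :* (v :* v))) := s :* ((con 16 :* (u :* v)) :* (con 16 :* (u :* v)))) refl u v s ⟩
    s ℕ.* (m ℕ.* m)                                        ∎

  -- The negation of `n (1 - k η) ≤ N` for `η = 3/(1 + m²)`, cleared of denominators: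
  -- `3 k n ≤ 6 k N`, while the excess contributes more than `s m² ≥ 16 k N`.
  too-many : N ℕ.* suc (m ℕ.* m) ℕ.+ 3 ℕ.* k ℕ.* n ℕ.< n ℕ.* suc (m ℕ.* m)
  too-many = begin-strict
    N ℕ.* suc q ℕ.+ 3 ℕ.* k ℕ.* n          ≤⟨ ℕ.+-monoʳ-≤ (N ℕ.* suc q) (ℕ.*-monoʳ-≤ (3 ℕ.* k) (ℕ.+-monoʳ-≤ N s≤N)) ⟩
    N ℕ.* suc q ℕ.+ 3 ℕ.* k ℕ.* (N ℕ.+ N)
      ≡⟨ cong (N ℕ.* suc q ℕ.+_) (solve 2 (λ k N → con 3 :* k :* (N :+ N) := con 6 :* (N :* k)) refl k N) ⟩
    N ℕ.* suc q ℕ.+ 6 ℕ.* (N ℕ.* k)        ≤⟨ ℕ.+-monoʳ-≤ (N ℕ.* suc q) (ℕ.*-monoˡ-≤ (N ℕ.* k) (ℕ.m≤m+n 6 10)) ⟩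
    N ℕ.* suc q ℕ.+ 16 ℕ.* (N ℕ.* k)       ≤⟨ ℕ.+-monoʳ-≤ (N ℕ.* suc q) 16Nk≤sm² ⟩
    N ℕ.* suc q ℕ.+ s ℕ.* q                <⟨ ℕ.+-monoʳ-< (N ℕ.* suc q) (ℕ.*-monoʳ-< s {{ℕ.>-nonZero 1≤s}} (ℕ.n<1+n q)) ⟩
    N ℕ.* suc q ℕ.+ s ℕ.* suc q            ≡⟨ ℕ.*-distribʳ-+ (suc q) N s ⟨
    n ℕ.* suc q                            ∎
    where q = m ℕ.* m

  2R≤ : R ℕ.+ R ℕ.≤ 256 ℕ.* ((k ℕ.* v) ℕ.* (u ℕ.* l))
  2R≤ = ℕ.≤-reflexive (solve 4 (λ k u v l → (con 16 :* (u :* v)) :* (con 8 :* (l :* k)) :+ (con 16 :* (u :* v)) :* (con 8 :* (l :* k))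
                                := con 256 :* ((k :* v) :* (u :* l))) refl k u v l)

  k*3≤1+m² : k ℕ.* 3 ℕ.≤ suc (m ℕ.* m)
  k*3≤1+m² = begin
    k ℕ.* 3          ≡⟨ ℕ.*-comm k 3 ⟩
    3 ℕ.* k          ≤⟨ ℕ.*-monoˡ-≤ k (ℕ.m≤m+n 3 13) ⟩
    16 ℕ.* k         ≤⟨ 16k≤m² ⟩
    m ℕ.* m          ≤⟨ ℕ.n≤1+n (m ℕ.* m) ⟩
    suc (m ℕ.* m)    ∎

  radius : ∃[ m ] ∃[ R ] (2 ℕ.≤ m × 3 ℕ.* (m ℕ.* m) ℕ.≤ suc m ℕ.^ R
    × n ℕ.* ((m ℕ.* m) ℕ.* (m ℕ.^ R ℕ.* m ℕ.^ R)) ℕ.≤ suc m ℕ.^ R ℕ.* suc m ℕ.^ R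
    × k ℕ.* 3 ℕ.≤ suc (m ℕ.* m)
    × N ℕ.* suc (m ℕ.* m) ℕ.+ 3 ℕ.* k ℕ.* n ℕ.< n ℕ.* suc (m ℕ.* m)
    × R ℕ.+ R ℕ.≤ 256 ℕ.* ((k ℕ.* v) ℕ.* (u ℕ.* l)))
  radius = m , R , 2≤m , 3m²≤[1+m]^R , far , k*3≤1+m² , too-many , 2R≤

-- The bound on the diameter as an inequality of cuts

¼ : ℚ
¼ = ½ * ½

¼<1 : ¼ < 1ℚ
¼<1 = from-yes (¼ <? 1ℚ)

½<1-¼ : ½ < 1ℚ - ¼
½<1-¼ = from-yes (½ <? 1ℚ - ¼)

0<½ : 0ℚ < ½
0<½ = from-yes (0ℚ <? ½)

x*¼<x : ∀ {x} → 0ℚ < x → x * ¼ < x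
x*¼<x {x} 0<x = subst (x * ¼ <_) (*-identityʳ x) (*-monoʳ-<-pos x {{positive 0<x}} ¼<1)

*-pos : ∀ {x y} → 0ℚ < x → 0ℚ < y → 0ℚ < x * y
*-pos {x} {y} 0<x 0<y = subst (_< x * y) (*-zeroʳ x) (*-monoʳ-<-pos x {{positive 0<x}} 0<y)

suc*unit-fraction : ∀ j → ℕ→ℚ (suc j) * (ℤ.+ 1 / suc j) ≡ 1ℚ
suc*unit-fraction j = toℚᵘ-injective (begin
  toℚᵘ (ℕ→ℚ (suc j) * (ℤ.+ 1 / suc j))            ≈⟨ toℚᵘ-homo-* (ℕ→ℚ (suc j)) (ℤ.+ 1 / suc j) ⟩
  toℚᵘ (ℕ→ℚ (suc j)) ℚᵘ.* toℚᵘ (ℤ.+ 1 / suc j)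
    ≈⟨ ℚᵘ.*-cong (toℚᵘ-fromℚᵘ (ℚᵘ.mkℚᵘ (ℤ.+ suc j) 0)) (toℚᵘ-fromℚᵘ (ℚᵘ.mkℚᵘ (ℤ.+ 1) j)) ⟩
  ℚᵘ.mkℚᵘ (ℤ.+ suc j) 0 ℚᵘ.* ℚᵘ.mkℚᵘ (ℤ.+ 1) j
    ≈⟨ ℚᵘ.*≡* (cong (λ x → ℤ.+ suc x) (trans (ℕ.*-identityʳ _) (trans (ℕ.*-identityʳ j) (sym (trans (ℕ.+-identityʳ _) (ℕ.+-identityʳ j)))))) ⟩
  toℚᵘ 1ℚ                                       ∎)
  where open ℚᵘ.≃-Reasoning

½^ : ∀ l → ℕ→ℚ (2 ℕ.^ l) * ½ ^ l ≡ 1ℚ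
½^ zero    = refl
½^ (suc l) = begin
  ℕ→ℚ (2 ℕ.* 2 ℕ.^ l) * (½ * ½ ^ l)    ≡⟨ cong (_* (½ * ½ ^ l)) (ℕ→ℚ-* 2 (2 ℕ.^ l)) ⟩
  ℕ→ℚ 2 * ℕ→ℚ (2 ℕ.^ l) * (½ * ½ ^ l)  ≡⟨ regroup (ℕ→ℚ 2) (ℕ→ℚ (2 ℕ.^ l)) ½ (½ ^ l) ⟩
  ℕ→ℚ 2 * ½ * (ℕ→ℚ (2 ℕ.^ l) * ½ ^ l)  ≡⟨ cong (ℕ→ℚ 2 * ½ *_) (½^ l) ⟩
  ℕ→ℚ 2 * ½ * 1ℚ                       ≡⟨⟩
  1ℚ                                   ∎
  where
  open ≡-Reasoning
  regroup : ∀ a x b y → a * x * (b * y) ≡ a * b * (x * y)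
  regroup = solve-∀ ℚ-ring

^-nonNeg : ∀ {x} → 0ℚ ≤ x → ∀ n → 0ℚ ≤ x ^ n
^-nonNeg 0≤x zero    = 0≤ℕ→ℚ 1
^-nonNeg 0≤x (suc n) = *-nonNeg 0≤x (^-nonNeg 0≤x n)

^-mono-< : ∀ {x y} → 0ℚ < x → x < y → ∀ n → x ^ suc n < y ^ suc n
^-mono-< {x} {y} 0<x x<y zero    = subst₂ _<_ (sym (*-identityʳ x)) (sym (*-identityʳ y)) x<y
^-mono-< {x} {y} 0<x x<y (suc n) = <-≤-trans
  (*-monoʳ-<-pos x {{positive 0<x}} (^-mono-< 0<x x<y n))
  (*-monoʳ-≤ (^-nonNeg (<⇒≤ (<-trans 0<x x<y)) (suc n)) (<⇒≤ x<y))

-- e^(-l/4) ≥ (1 - 1/4)^l > 2^(-l) ≥ 1/r.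
l/4∈log : ∀ {r} l → 1 ℕ.≤ l → 2 ℕ.^ l ℕ.≤ r → log r (ℕ→ℚ l * ¼)
-- The index `j` of the supremum defining `exp` has `suc j = l`, which makes the base exactly
-- `1 - 1/4`; the witness below `e^(-l/4)` is `2^(-l)`.
l/4∈log {r} (suc j) _ 2^l≤r = ½ ^ suc j , (j , base-nonNeg , power<) , (begin
  1ℚ                            ≡⟨ ½^ (suc j) ⟨
  ℕ→ℚ (2 ℕ.^ suc j) * ½ ^ suc j  ≤⟨ *-monoʳ-≤ (^-nonNeg (<⇒≤ 0<½) (suc j)) (ℕ→ℚ-mono-≤ {2 ℕ.^ suc j} {r} 2^l≤r) ⟩
  ℕ→ℚ r * ½ ^ suc j              ∎)
  where
  open ≤-Reasoning
  L = ℕ→ℚ (suc j)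
  regroup : ∀ L q x → 1ℚ + - (L * q) * x ≡ 1ℚ - L * x * q
  regroup = solve-∀ ℚ-ring
  base≡ : 1ℚ + - (L * ¼) * (ℤ.+ 1 / suc j) ≡ 1ℚ - ¼
  base≡ = trans (regroup L ¼ (ℤ.+ 1 / suc j)) (cong (λ y → 1ℚ - y) (trans (cong (_* ¼) (suc*unit-fraction j)) (*-identityˡ ¼)))
  base-nonNeg : 0ℚ ≤ 1ℚ + - (L * ¼) * (ℤ.+ 1 / suc j)
  base-nonNeg = subst (0ℚ ≤_) (sym base≡) (0≤y-x (<⇒≤ ¼<1))
  power< : ½ ^ suc j < (1ℚ + - (L * ¼) * (ℤ.+ 1 / suc j)) ^ suc j
  power< = subst (λ x → ½ ^ suc j < x ^ suc j) (sym base≡) (^-mono-< 0<½ ½<1-¼ j)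

-- From `v² ≤ k` follows `(k v)² ≤ k³`; halving gives the strict inequality that an open cut
-- requires.
kv/2∈k^3/2 : ∀ {k v} → 1 ℕ.≤ k → 1 ℕ.≤ v → v ℕ.* v ℕ.≤ k → (k ^³ᐟ²) (ℕ→ℚ (k ℕ.* v) * ½)
kv/2∈k^3/2 {k} {v} 1≤k 1≤v v²≤k = inj₂ (begin-strict
  ℕ→ℚ kv * ½ * (ℕ→ℚ kv * ½)  ≡⟨ regroup (ℕ→ℚ kv) ½ ⟩
  ℕ→ℚ kv * ℕ→ℚ kv * ¼         <⟨ x*¼<x (*-pos 0<kv 0<kv) ⟩
  ℕ→ℚ kv * ℕ→ℚ kv             ≡⟨ ℕ→ℚ-* kv kv ⟨
  ℕ→ℚ (kv ℕ.* kv)             ≤⟨ ℕ→ℚ-mono-≤ {kv ℕ.* kv} {k ℕ.^ 3} k²v²≤k³ ⟩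
  ℕ→ℚ (k ℕ.^ 3)               ∎)
  where
  open ≤-Reasoning
  kv = k ℕ.* v
  0<kv : 0ℚ < ℕ→ℚ kv
  0<kv = ℕ→ℚ-mono-< {0} {kv} (ℕ.*-mono-≤ 1≤k 1≤v)
  regroup : ∀ x h → x * h * (x * h) ≡ x * x * (h * h)
  regroup = solve-∀ ℚ-ring
  k²v²≤k³ : kv ℕ.* kv ℕ.≤ k ℕ.^ 3
  k²v²≤k³ = ℕ.≤-trans (ℕ.≤-reflexive (solve 2 (λ k v → (k :* v) :* (k :* v) := k :* (k :* (v :* v))) refl k v))
    (ℕ.*-monoʳ-≤ k (ℕ.*-monoʳ-≤ k (ℕ.≤-trans v²≤k (ℕ.≤-reflexive (sym (ℕ.*-identityʳ k))))))
    where open +-*-Solver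

-- Here `u² ≤ 1/δ`, and the half again provides strictness.
u/2∈δ^-½ : ∀ δ .{{_ : Positive δ}} {u} → 1 ℕ.≤ u → ℕ→ℚ (u ℕ.* u) * δ ≤ 1ℚ → (δ ^-½) (ℕ→ℚ u * ½)
u/2∈δ^-½ δ {u} 1≤u u²δ≤1 = inj₂ (begin-strict
  ℕ→ℚ u * ½ * (ℕ→ℚ u * ½)    ≡⟨ regroup (ℕ→ℚ u) ½ ⟩
  ℕ→ℚ u * ℕ→ℚ u * ¼          <⟨ x*¼<x (*-pos 0<u 0<u) ⟩
  ℕ→ℚ u * ℕ→ℚ u              ≡⟨ ℕ→ℚ-* u u ⟨
  U                          ≡⟨ *-identityʳ U ⟨
  U * 1ℚ                     ≡⟨ cong (U *_) (*-inverseʳ δ {{δ≢0}}) ⟨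
  U * (δ * δ⁻¹)              ≡⟨ *-assoc U δ δ⁻¹ ⟨
  U * δ * δ⁻¹                ≤⟨ *-monoʳ-≤ (<⇒≤ (positive⁻¹ δ⁻¹ {{1/pos⇒pos δ}})) u²δ≤1 ⟩
  1ℚ * δ⁻¹                   ≡⟨ *-identityˡ δ⁻¹ ⟩
  δ⁻¹                        ∎)
  where
  open ≤-Reasoning
  δ≢0 = pos⇒nonZero δ
  δ⁻¹ = (1/ δ) {{pos⇒nonZero δ}}
  U = ℕ→ℚ (u ℕ.* u)
  0<u : 0ℚ < ℕ→ℚ u
  0<u = ℕ→ℚ-mono-< {0} {u} 1≤u
  regroup : ∀ x h → x * h * (x * h) ≡ x * x * (h * h)
  regroup = solve-∀ ℚ-ring

*-suc-< : ∀ a {x} → 0ℚ < x → ℕ→ℚ a * x < ℕ→ℚ (suc a) * x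
*-suc-< a {x} 0<x = *-monoˡ-<-pos x {{positive 0<x}} (ℕ→ℚ-mono-< {a} {suc a} ℕ.≤-refl)

-- The bound 256 k v u l on the diameter equals 4096 (k v / 2) (u / 2) (l / 4). Cuts being open, 4097
-- and 4098 leave room for the strict inequalities in the definition of the product.
diameter-bound : ∀ {r k u v l d} δ .{{_ : Positive δ}} →
  1 ℕ.≤ k → 1 ℕ.≤ u → 1 ℕ.≤ v → 1 ℕ.≤ l →
  ℕ→ℚ (u ℕ.* u) * δ ≤ 1ℚ → v ℕ.* v ℕ.≤ k → 2 ℕ.^ l ℕ.≤ r →
  d ℕ.≤ 256 ℕ.* ((k ℕ.* v) ℕ.* (u ℕ.* l)) →
  ℕ→ℝ d ≤ᴿ ℚ→ℝ (ℕ→ℚ 4099) · k ^³ᐟ² · δ ^-½ · log r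
diameter-bound {r} {k} {u} {v} {l} {d} δ 1≤k 1≤u 1≤v 1≤l u²δ≤1 v²≤k 2^l≤r d≤ {q} q<d =
  inj₂ (ℕ→ℚ 4096 * (x * y) , ℕ→ℚ l * ¼ , *-nonNeg (0≤ℕ→ℚ 4096) (<⇒≤ 0<xy) , *-nonNeg (0≤ℕ→ℚ l) (<⇒≤ (*-pos 0<½ 0<½)) ,
    inj₂ (ℕ→ℚ 4097 * x , y , *-nonNeg (0≤ℕ→ℚ 4097) (<⇒≤ 0<x) , <⇒≤ 0<y ,
      inj₂ (ℕ→ℚ 4098 , x , 0≤ℕ→ℚ 4098 , <⇒≤ 0<x , ℕ→ℚ-mono-< {4098} {4099} ℕ.≤-refl , kv/2∈k^3/2 1≤k 1≤v v²≤k , *-suc-< 4097 0<x) ,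
      u/2∈δ^-½ δ 1≤u u²δ≤1 ,
      subst (ℕ→ℚ 4096 * (x * y) <_) (sym (*-assoc (ℕ→ℚ 4097) x y)) (*-suc-< 4096 0<xy)) ,
    l/4∈log l 1≤l 2^l≤r ,
    <-≤-trans q<d (begin
      ℕ→ℚ d                                      ≤⟨ ℕ→ℚ-mono-≤ {d} {256 ℕ.* (kv ℕ.* (u ℕ.* l))} d≤ ⟩
      ℕ→ℚ (256 ℕ.* (kv ℕ.* (u ℕ.* l)))
        ≡⟨ trans (ℕ→ℚ-* 256 (kv ℕ.* (u ℕ.* l))) (cong (ℕ→ℚ 256 *_) (trans (ℕ→ℚ-* kv (u ℕ.* l)) (cong (ℕ→ℚ kv *_) (ℕ→ℚ-* u l)))) ⟩
      ℕ→ℚ 256 * (ℕ→ℚ kv * (ℕ→ℚ u * ℕ→ℚ l))       ≡⟨⟩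
      ℕ→ℚ 4096 * ½ * ½ * ½ * ½ * (ℕ→ℚ kv * (ℕ→ℚ u * ℕ→ℚ l))  ≡⟨ regroup (ℕ→ℚ 4096) ½ (ℕ→ℚ kv) (ℕ→ℚ u) (ℕ→ℚ l) ⟩
      ℕ→ℚ 4096 * (x * y) * (ℕ→ℚ l * ¼)           ∎))
  where
  open ≤-Reasoning
  kv = k ℕ.* v
  x = ℕ→ℚ kv * ½
  y = ℕ→ℚ u * ½
  0<x : 0ℚ < x
  0<x = *-pos (ℕ→ℚ-mono-< {0} {kv} (ℕ.*-mono-≤ 1≤k 1≤v)) 0<½
  0<y : 0ℚ < y
  0<y = *-pos (ℕ→ℚ-mono-< {0} {u} 1≤u) 0<½
  0<xy : 0ℚ < x * y
  0<xy = *-pos 0<x 0<y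
  regroup : ∀ w h a b c → w * h * h * h * h * (a * (b * c)) ≡ w * (a * h * (b * h)) * (c * (h * h))
  regroup = solve-∀ ℚ-ring

-- The integral excess and the conclusion

-- As `n` and `N` are integers, so is `δ N`; being positive, it is at least 1.
excess : ∀ {n N} δ → 0ℚ < δ → δ ≤ 1ℚ → 1 ℕ.≤ N → ℕ→ℚ n ≡ (1ℚ + δ) * ℕ→ℚ N →
         ∃[ s ] (n ≡ N ℕ.+ s × ℕ→ℚ s ≡ δ * ℕ→ℚ N × 1 ℕ.≤ s × s ℕ.≤ N)
excess {n} {N} δ 0<δ δ≤1 1≤N n≡ = s , sym (ℕ.m+[n∸m]≡n N≤n) , s≡ , 1≤s , s≤N
  where
  open ≤-Reasoning
  s = n ℕ.∸ N
  0<N : 0ℚ < ℕ→ℚ N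
  0<N = ℕ→ℚ-mono-< {0} {N} 1≤N
  expand : ∀ δ N → (1ℚ + δ) * N ≡ N + δ * N
  expand = solve-∀ ℚ-ring
  N≤n : N ℕ.≤ n
  N≤n = ℕ→ℚ-cancel-≤ {N} {n} (≤-by (<⇒≤ (*-pos 0<δ 0<N)) (trans n≡ (expand δ (ℕ→ℚ N))))
  s≡ : ℕ→ℚ s ≡ δ * ℕ→ℚ N
  s≡ = +-cancelˡ (ℕ→ℚ N) (ℕ→ℚ s) (δ * ℕ→ℚ N) (begin-equality
    ℕ→ℚ N + ℕ→ℚ s          ≡⟨ ℕ→ℚ-+ N s ⟨
    ℕ→ℚ (N ℕ.+ s)          ≡⟨ cong ℕ→ℚ (ℕ.m+[n∸m]≡n N≤n) ⟩
    ℕ→ℚ n                  ≡⟨ trans n≡ (expand δ (ℕ→ℚ N)) ⟩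
    ℕ→ℚ N + δ * ℕ→ℚ N      ∎)
  1≤s : 1 ℕ.≤ s
  1≤s = ℕ.≰⇒> (λ s≤0 → <-irrefl refl (<-≤-trans (subst (0ℚ <_) (sym s≡) (*-pos 0<δ 0<N)) (ℕ→ℚ-mono-≤ {s} {0} s≤0)))
  s≤N : s ℕ.≤ N
  s≤N = ℕ→ℚ-cancel-≤ {s} {N} (begin
    ℕ→ℚ s          ≡⟨ s≡ ⟩
    δ * ℕ→ℚ N      ≤⟨ *-monoʳ-≤ (<⇒≤ 0<N) δ≤1 ⟩
    1ℚ * ℕ→ℚ N     ≡⟨ *-identityˡ (ℕ→ℚ N) ⟩
    ℕ→ℚ N          ∎)

u²δ≤1 : ∀ {u s N} δ → 1 ℕ.≤ N → ℕ→ℚ s ≡ δ * ℕ→ℚ N → u ℕ.* u ℕ.* s ℕ.≤ N → ℕ→ℚ (u ℕ.* u) * δ ≤ 1ℚ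
u²δ≤1 {u} {s} {N} δ 1≤N s≡ u²s≤N = *-cancelʳ-≤-pos (ℕ→ℚ N) {{positive (ℕ→ℚ-mono-< {0} {N} 1≤N)}} (begin
  ℕ→ℚ (u ℕ.* u) * δ * ℕ→ℚ N      ≡⟨ *-assoc (ℕ→ℚ (u ℕ.* u)) δ (ℕ→ℚ N) ⟩
  ℕ→ℚ (u ℕ.* u) * (δ * ℕ→ℚ N)    ≡⟨ cong (ℕ→ℚ (u ℕ.* u) *_) s≡ ⟨
  ℕ→ℚ (u ℕ.* u) * ℕ→ℚ s          ≡⟨ ℕ→ℚ-* (u ℕ.* u) s ⟨
  ℕ→ℚ (u ℕ.* u ℕ.* s)            ≤⟨ ℕ→ℚ-mono-≤ {u ℕ.* u ℕ.* s} {N} u²s≤N ⟩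
  ℕ→ℚ N                          ≡⟨ *-identityˡ (ℕ→ℚ N) ⟨
  1ℚ * ℕ→ℚ N                     ∎)
  where open ≤-Reasoning

clear-denominator : ∀ n N k W η → η * ℕ→ℚ W ≡ ℕ→ℚ 3 → ℕ→ℚ n * (1ℚ - ℕ→ℚ k * η) ≤ ℕ→ℚ N →
                    n ℕ.* W ℕ.≤ N ℕ.* W ℕ.+ 3 ℕ.* k ℕ.* n
clear-denominator n N k W η ηW≡3 n[1-kη]≤N = ℕ→ℚ-cancel-≤ {n ℕ.* W} {N ℕ.* W ℕ.+ 3 ℕ.* k ℕ.* n} (begin
  ℕ→ℚ (n ℕ.* W)
    ≡⟨ ℕ→ℚ-* n W ⟩
  ℕ→ℚ n * ℕ→ℚ W
    ≡⟨ regroup (ℕ→ℚ n) (ℕ→ℚ k) η (ℕ→ℚ W) ⟩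
  ℕ→ℚ n * (1ℚ - ℕ→ℚ k * η) * ℕ→ℚ W + η * ℕ→ℚ W * ℕ→ℚ k * ℕ→ℚ n
    ≤⟨ +-monoˡ-≤ (η * ℕ→ℚ W * ℕ→ℚ k * ℕ→ℚ n) (*-monoʳ-≤ (0≤ℕ→ℚ W) n[1-kη]≤N) ⟩
  ℕ→ℚ N * ℕ→ℚ W + η * ℕ→ℚ W * ℕ→ℚ k * ℕ→ℚ n
    ≡⟨ cong (λ x → ℕ→ℚ N * ℕ→ℚ W + x * ℕ→ℚ k * ℕ→ℚ n) ηW≡3 ⟩
  ℕ→ℚ N * ℕ→ℚ W + ℕ→ℚ 3 * ℕ→ℚ k * ℕ→ℚ n
    ≡⟨ cong₂ _+_ (ℕ→ℚ-* N W) (trans (ℕ→ℚ-* (3 ℕ.* k) n) (cong (_* ℕ→ℚ n) (ℕ→ℚ-* 3 k))) ⟨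
  ℕ→ℚ (N ℕ.* W) + ℕ→ℚ (3 ℕ.* k ℕ.* n)
    ≡⟨ ℕ→ℚ-+ (N ℕ.* W) (3 ℕ.* k ℕ.* n) ⟨
  ℕ→ℚ (N ℕ.* W ℕ.+ 3 ℕ.* k ℕ.* n) ∎)
  where
  open ≤-Reasoning
  regroup : ∀ n k η W → n * W ≡ n * (1ℚ - k * η) * W + η * W * k * n
  regroup = solve-∀ ℚ-ring

unit-multiple : ∀ a k q → k ℕ.* a ℕ.≤ suc q →
                ∃[ η ] (0ℚ ≤ η × η * ℕ→ℚ (suc q) ≡ ℕ→ℚ a × ℕ→ℚ k * η ≤ 1ℚ)
unit-multiple a k q ka≤1+q = from-reciprocal (reciprocal q)
  where
  from-reciprocal : ∃[ g ] (g * ℕ→ℚ (suc q) ≡ 1ℚ × 0ℚ ≤ g) → _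
  from-reciprocal (g , gW≡1 , 0≤g) =
    ℕ→ℚ a * g , *-nonNeg (0≤ℕ→ℚ a) 0≤g ,
    trans (*-assoc (ℕ→ℚ a) g (ℕ→ℚ (suc q))) (trans (cong (ℕ→ℚ a *_) gW≡1) (*-identityʳ (ℕ→ℚ a))) ,
    (begin
      ℕ→ℚ k * (ℕ→ℚ a * g)    ≡⟨ *-assoc (ℕ→ℚ k) (ℕ→ℚ a) g ⟨
      ℕ→ℚ k * ℕ→ℚ a * g      ≡⟨ cong (_* g) (ℕ→ℚ-* k a) ⟨
      ℕ→ℚ (k ℕ.* a) * g      ≤⟨ *-monoʳ-≤ 0≤g (ℕ→ℚ-mono-≤ {k ℕ.* a} {suc q} ka≤1+q) ⟩
      ℕ→ℚ (suc q) * g        ≡⟨ trans (*-comm (ℕ→ℚ (suc q)) g) gW≡1 ⟩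
      1ℚ                     ∎)
    where open ≤-Reasoning

colourable-balls-bound : ∀ {n k} (χ : EdgeColouring (K n) k) r R η → 1 ℕ.≤ r → 0ℚ ≤ η → ℕ→ℚ k * η ≤ 1ℚ →
  (∀ i → SmoothWeights (colourClass χ i) R η) →
  (∀ i c → FinColourable (ball (colourClass χ i) R c) r) →
  ℕ→ℚ n * (1ℚ - ℕ→ℚ k * η) ≤ ℕ→ℚ (r ℕ.^ k)
colourable-balls-bound {n} χ r R η 1≤r 0≤η kη≤1 weights colouring =
  local-colourings-bound r η 1≤r 0≤η kη≤1 h φ (λ i → nonNeg (weights i)) (λ i → norm (weights i)) edge
  where
  open SmoothWeights using (nonNeg; norm; support; close)
  h = λ i → SmoothWeights.h (weights i)
  φ = λ i c → proj₁ (colouring i c)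
  edge : ∀ u v → u ≢ v → ∃[ i ] ((∀ c → h i c u * h i c v ≡ 0ℚ ⊎ φ i c u ≢ φ i c v)
                                 × 1ℚ - η ≤ sum (λ c → h i c u * h i c v))
  -- Every pair is an edge in the class of its own colour, and the weights of that class are close
  -- on it.
  edge u v u≢v = i , (λ c → proper c (support (weights i) (u≢v , refl) c)) , close (weights i) (u≢v , refl)
    where
    i = colour χ u≢v
    proper : ∀ c → h i c u * h i c v ≡ 0ℚ ⊎ E (ball (colourClass χ i) R c) u v →
             h i c u * h i c v ≡ 0ℚ ⊎ φ i c u ≢ φ i c v
    proper c (inj₁ hh≡0) = inj₁ hh≡0
    proper c (inj₂ e)    = inj₂ (proj₂ (colouring i c) u v e)

some-ball-not-colourable : ∀ {n k} (χ : EdgeColouring (K n) k) r m R → 1 ℕ.≤ r → 2 ℕ.≤ m →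
  3 ℕ.* (m ℕ.* m) ℕ.≤ suc m ℕ.^ R →
  n ℕ.* ((m ℕ.* m) ℕ.* (m ℕ.^ R ℕ.* m ℕ.^ R)) ℕ.≤ suc m ℕ.^ R ℕ.* suc m ℕ.^ R →
  k ℕ.* 3 ℕ.≤ suc (m ℕ.* m) →
  r ℕ.^ k ℕ.* suc (m ℕ.* m) ℕ.+ 3 ℕ.* k ℕ.* n ℕ.< n ℕ.* suc (m ℕ.* m) →
  ¬ (∀ i c → FinColourable (ball (colourClass χ i) R c) r)
some-ball-not-colourable {n} {k} χ r m R 1≤r 2≤m 3m²≤ far 3k≤ too-many colouring =
  -- This takes `η = 3/(1 + m²)`, the least value that `smoothWeights` admits.
  refute (unit-multiple 3 k (m ℕ.* m) 3k≤)
  where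
  refute : ¬ (∃[ η ] (0ℚ ≤ η × η * ℕ→ℚ (suc (m ℕ.* m)) ≡ ℕ→ℚ 3 × ℕ→ℚ k * η ≤ 1ℚ))
  refute (η , 0≤η , ηW≡3 , kη≤1) = ℕ.<⇒≱ too-many
    (clear-denominator n (r ℕ.^ k) k (suc (m ℕ.* m)) η ηW≡3
      (colourable-balls-bound χ r R η 1≤r 0≤η kη≤1
        (λ i → smoothWeights (colourClass χ i) (λ _ → ∈⊤) m R η 2≤m 3m²≤ far
          (≤-reflexive (trans (sym ηW≡3) (cong (η *_) (ℕ→ℚ-+ 1 (m ℕ.* m))))))
        colouring))

-- The condition `P` on the diameter is first `d ≤ 2R` and then the inequality of cuts.
LargeSubgraph : ∀ {n k} → EdgeColouring (K n) k → ℕ → (ℕ → Set) → Set₁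
LargeSubgraph {n} χ r P = Σ (Graph n) λ H → Σ (H ⊆ᴳ K n) λ H⊆K →
  Monochromatic χ H⊆K
  × (∃[ χ ] (IsChromaticNumber H χ × r ℕ.+ 1 ℕ.≤ χ))
  × (∃[ d ] (IsDiameter H d × P d))

weaken-bound : ∀ {n k} {χ : EdgeColouring (K n) k} {r P Q} → (∀ {d} → P d → Q d) →
               LargeSubgraph χ r P → LargeSubgraph χ r Q
weaken-bound P⇒Q (H , H⊆K , mono , χ>r , d , isDiameter , p) = H , H⊆K , mono , χ>r , d , isDiameter , P⇒Q p

-- There are finitely many balls and their colourability is decidable, so the negated universal
-- statement yields an actual ball.
monochromatic-ball : ∀ {n k} (χ : EdgeColouring (K n) k) r R → 1 ℕ.≤ r →
  ¬ (∀ i c → FinColourable (ball (colourClass χ i) R c) r) → LargeSubgraph χ r (ℕ._≤ R ℕ.+ R)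
monochromatic-ball χ r@(suc _) R 1≤r not-all
  with Fin.any? (λ i → Fin.any? (λ c → ¬? (finColourable? (ball (colourClass χ i) R c) r)))
... | no none = contradiction
  (λ i c → decidable-stable (finColourable? (ball (colourClass χ i) R c) r) (λ ¬col → none (i , c , ¬col)))
  not-all
... | yes (i , c , ¬col) =
  ball (colourClass χ i) R c , ball⊆K χ i R c , ball-monochromatic χ i R c ,
  ¬colourable⇒χ>r (ball (colourClass χ i) R c) (λ col → ¬col (colourable⇒fin (ball (colourClass χ i) R c) col)) ,
  ball-diameter (colourClass χ i) R {c} ∈⊤

large-subgraph : ∀ {r k s} (δ : ℚ) .{{_ : Positive δ}} → 2 ℕ.≤ r → 1 ℕ.≤ k →
  ℕ→ℚ s ≡ δ * ℕ→ℚ (r ℕ.^ k) → 1 ℕ.≤ s → s ℕ.≤ r ℕ.^ k → (χ : EdgeColouring (K (r ℕ.^ k ℕ.+ s)) k) →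
  LargeSubgraph χ r (λ d → ℕ→ℝ d ≤ᴿ ℚ→ℝ (ℕ→ℚ 4099) · k ^³ᐟ² · δ ^-½ · log r)
large-subgraph {r} {k} {s} δ 2≤r 1≤k s≡ 1≤s s≤N χ = from-radius (Radius.radius 1≤k 2≤r 1≤s s≤N params)
  where
  params : Parameters r k (r ℕ.^ k) s
  params = parameters 2≤r 1≤k 1≤s s≤N
  open Parameters params
  from-radius : _ → LargeSubgraph χ r (λ d → ℕ→ℝ d ≤ᴿ ℚ→ℝ (ℕ→ℚ 4099) · k ^³ᐟ² · δ ^-½ · log r)
  from-radius (m , R , 2≤m , 3m²≤ , far , 3k≤ , too-many , 2R≤) = weaken-bound
    {χ = χ} {r} {ℕ._≤ R ℕ.+ R} {λ d → ℕ→ℝ d ≤ᴿ ℚ→ℝ (ℕ→ℚ 4099) · k ^³ᐟ² · δ ^-½ · log r}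
    (λ d≤2R → diameter-bound δ 1≤k 1≤u 1≤v 1≤l (u²δ≤1 {u} δ (ℕ.≤-trans 1≤s s≤N) s≡ u²s≤N) v²≤k 2^l≤r (ℕ.≤-trans d≤2R 2R≤))
    (monochromatic-ball χ r R (ℕ.<⇒≤ 2≤r) (some-ball-not-colourable χ r m R (ℕ.<⇒≤ 2≤r) 2≤m 3m²≤ far 3k≤ too-many))

theorem1p4 : ∃[ C ] (Positive C ×
    (∀ (r k : ℕ) → 2 ℕ.≤ r → 1 ℕ.≤ k →
    ∀ (δ : ℚ) .{{_ : Positive δ}} → δ ≤ 1ℚ →
    ∀ (n : ℕ) → ℕ→ℚ n ≡ (1ℚ + δ) * ℕ→ℚ (r ℕ.^ k) →
    ∀ (c : EdgeColouring (K n) k) →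
    Σ (Graph n) λ H → Σ (H ⊆ᴳ K n) λ H⊆K →
    Monochromatic c H⊆K
    × (∃[ χ ] (IsChromaticNumber H χ × r ℕ.+ 1 ℕ.≤ χ))
    × (∃[ d ] (IsDiameter H d
    × ℕ→ℝ d ≤ᴿ ℚ→ℝ C · k ^³ᐟ² · δ ^-½ · log r))))
theorem1p4 = ℕ→ℚ 4099 , positive (ℕ→ℚ-mono-< {0} {4099} (ℕ.s≤s ℕ.z≤n)) , bounded
  where
  from-excess : ∀ {r k δ n} .{{_ : Positive δ}} → 2 ℕ.≤ r → 1 ℕ.≤ k →
    ∃[ s ] (n ≡ r ℕ.^ k ℕ.+ s × ℕ→ℚ s ≡ δ * ℕ→ℚ (r ℕ.^ k) × 1 ℕ.≤ s × s ℕ.≤ r ℕ.^ k) →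
    (χ : EdgeColouring (K n) k) → LargeSubgraph χ r (λ d → ℕ→ℝ d ≤ᴿ ℚ→ℝ (ℕ→ℚ 4099) · k ^³ᐟ² · δ ^-½ · log r)
  from-excess {δ = δ} 2≤r 1≤k (s , refl , s≡ , 1≤s , s≤N) χ = large-subgraph δ 2≤r 1≤k s≡ 1≤s s≤N χ
  bounded : ∀ r k → 2 ℕ.≤ r → 1 ℕ.≤ k → ∀ δ .{{_ : Positive δ}} → δ ≤ 1ℚ →
    ∀ n → ℕ→ℚ n ≡ (1ℚ + δ) * ℕ→ℚ (r ℕ.^ k) → (χ : EdgeColouring (K n) k) →
    LargeSubgraph χ r (λ d → ℕ→ℝ d ≤ᴿ ℚ→ℝ (ℕ→ℚ 4099) · k ^³ᐟ² · δ ^-½ · log r)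
  bounded r k 2≤r 1≤k δ δ≤1 n n≡ = from-excess 2≤r 1≤k
    (excess {n} {r ℕ.^ k} δ (positive⁻¹ δ) δ≤1 (ℕ.m^n>0 r {{ℕ.>-nonZero (ℕ.<⇒≤ 2≤r)}} k) n≡)
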